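{- Let $n\ge 1$, let $\Lambda_n\subset\mathbb{Q}[x_1,\dots,x_n]$ be the algebra of symmetric polynomials in $n$ variables over $\mathbb{Q}$, and let $p_k=x_1^k+x_2^k+\cdots+x_n^k$. Consider the operators on $\Lambda_n$ $$D_+=\sum_{i=1}^n x_i^2\frac{\partial}{\partial x_i},\qquad D_-=-\sum_{i=1}^n\frac{\partial}{\partial x_i},$$ and for $i=2,3,\dots,n$ put $$z_i=\sum_{k=0}^{i-2}(-1)^k n^{i-k-1}\binom{i}{k}p_{i-k}\,p_1^k+(i-1)(-1)^{i+1}p_1^i .$$ Then: (i) $\ker D_-=\mathbb{Q}[z_2,z_3,\dots,z_n]$; (ii) $\ker D_+=\mathbb{Q}$; (iii) $\Lambda_n=\mathbb{Q}[p_1,z_2,z_3,\dots,z_n]$.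
   Context: Both operators map symmetric polynomials to symmetric polynomials, and they are considered as linear operators on $\Lambda_n$ only; thus $\ker D_\pm=\{f\in\Lambda_n : D_\pm(f)=0\}$. For elements $a_1,\dots,a_m\in\Lambda_n$, $\mathbb{Q}[a_1,\dots,a_m]$ denotes the $\mathbb{Q}$-subalgebra of $\Lambda_n$ they generate (equal to $\mathbb{Q}$ if the list is empty). -}

module Defs where

open import Algebra.Bundles.Raw using (RawRing)
import Algebra.Definitions.RawSemiring as SemiringDefinitions
open import Data.Bool.Base using (if_then_else_)
open import Data.Fin.Base using (Fin; toℕ)
open import Data.Fin.Permutation using (Permutation′; _⟨$⟩ˡ_)
open import Data.Integer.Base as ℤ using (ℤ; +_; -1ℤ)
open import Data.List.Base using (List; []; _∷_; [_]; _++_; map; cartesianProductWith; applyUpTo)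
open import Data.List.Membership.Propositional using (_∈_)
open import Data.Nat.Base as ℕ using (ℕ; _∸_)
open import Data.Nat.Combinatorics using (_C_)
import Data.Nat.Properties as ℕ
open import Data.Product.Base using (_×_; _,_; ∃)
open import Data.Rational.Base as ℚ using (ℚ; 0ℚ; 1ℚ)
open import Data.Vec.Base as Vec using (Vec; lookup; tabulate; zipWith; replicate; _[_]%=_; _[_]≔_)
open import Data.Vec.Properties using (≡-dec)
open import Level using (0ℓ)
open import Relation.Binary.PropositionalEquality using (_≡_)
open import Relation.Nullary.Decidable using (does)
open import Relation.Unary using (Pred)

-- The exponent vector a stands for x₁^a₁ ⋯ xₙ^aₙ.
Monomial : ℕ → Set
Monomial n = Vec ℕ n

-- A polynomial in ℚ[x₁,…,xₙ] is a finite formal sum of terms c·xᵃ.  The same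
-- monomial may occur several times and coefficients may vanish, so polynomials
-- are always compared with _≈_, i.e. by their coefficients.
Poly : ℕ → Set
Poly n = List (ℚ × Monomial n)

private variable n : ℕ

coeff : Poly n → Monomial n → ℚ
coeff []            m = 0ℚ
coeff ((c , a) ∷ f) m =
  (if does (≡-dec ℕ._≟_ a m) then c else 0ℚ) ℚ.+ coeff f m

infix 4 _≈_
record _≈_ (f g : Poly n) : Set where
  constructor mk≈
  field coeff-≡ : ∀ m → coeff f m ≡ coeff g m
open _≈_ public

mulTerm : ℚ × Monomial n → ℚ × Monomial n → ℚ × Monomial n
mulTerm (c , a) (d , b) = c ℚ.* d , zipWith ℕ._+_ a b

const : ℚ → Poly n
const {n} c = [ c , replicate n 0 ]

var : Fin n → Poly n
var {n} i = [ 1ℚ , replicate n 0 [ i ]≔ 1 ]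

polyRawRing : ℕ → RawRing 0ℓ 0ℓ
polyRawRing n = record
  { Carrier = Poly n
  ; _≈_     = _≈_
  ; _+_     = _++_
  ; _*_     = cartesianProductWith mulTerm
  ; -_      = map λ (c , a) → ℚ.- c , a
  ; 0#      = []
  ; 1#      = const 1ℚ
  }

fromℤ : ℤ → ℚ
fromℤ j = j ℚ./ 1

-- If aᵢ = 0, the truncated exponent is harmless: the coefficient becomes 0.
∂ : Fin n → Poly n → Poly n
∂ i = map λ (c , a) → fromℤ (+ lookup a i) ℚ.* c , a [ i ]%= ℕ.pred

-- The substitution xᵢ ↦ x_{σ(i)}.
permute : Permutation′ n → Poly n → Poly n
permute σ = map λ (c , a) → c , tabulate λ j → lookup a (σ ⟨$⟩ˡ j)

Λ : ∀ n → Pred (Poly n) 0ℓ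
Λ n f = ∀ (σ : Permutation′ n) → permute σ f ≈ f

module _ {n : ℕ} where
  open RawRing (polyRawRing n) using (_+_; _*_; 0#)

  -- The kernel of the restriction of D to Λₙ.
  ker : (Poly n → Poly n) → Pred (Poly n) 0ℓ
  ker D f = Λ n f × D f ≈ 0#

  Constant : Pred (Poly n) 0ℓ
  Constant f = ∃ λ c → f ≈ const c

  -- The ℚ-subalgebra generated by a list; closure under negation and scalars
  -- follows from multiplication by constants.
  data ℚ[_] (as : List (Poly n)) : Pred (Poly n) 0ℓ where
    const∈ : ∀ c → ℚ[ as ] (const c)
    gen∈   : ∀ {a} → a ∈ as → ℚ[ as ] a
    +∈     : ∀ {f g} → ℚ[ as ] f → ℚ[ as ] g → ℚ[ as ] (f + g)
    *∈     : ∀ {f g} → ℚ[ as ] f → ℚ[ as ] g → ℚ[ as ] (f * g)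
    ≈∈     : ∀ {f g} → f ≈ g → ℚ[ as ] f → ℚ[ as ] g

module _ (n : ℕ) where
  open RawRing (polyRawRing n) using (_+_; _*_; -_; rawSemiring)
  open SemiringDefinitions rawSemiring using (_^_; sum)

  D₊ D₋ : Poly n → Poly n
  D₊ f = sum λ i → var i ^ 2 * ∂ i f
  D₋ f = - sum λ i → ∂ i f

  p : ℕ → Poly n
  p k = sum λ (i : Fin n) → var i ^ k

  -- Used for i ≥ 2 only, where none of the subtractions truncates; the index
  -- κ : Fin (i ∸ 1) makes k run over 0, …, i − 2.
  z : ℕ → Poly n
  z i = sum (λ (κ : Fin (i ∸ 1)) → let k = toℕ κ in
              const (fromℤ (-1ℤ ℤ.^ k ℤ.* + (n ℕ.^ (i ∸ k ∸ 1)) ℤ.* + (i C k)))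
                * p (i ∸ k) * p 1 ^ k)
        + const (fromℤ (+ (i ∸ 1) ℤ.* -1ℤ ℤ.^ (i ℕ.+ 1))) * p 1 ^ i

  -- z₂, …, zₙ (empty when n = 1).
  zs : List (Poly n)
  zs = map z (applyUpTo (2 ℕ.+_) (n ∸ 1))

-- The augmented monomials Σ_t x_{t₁}^{a₁} ⋯ x_{tᵣ}^{aᵣ}, t running over injective
-- tuples, satisfy a recursion through multiplication by power sums, which makes
-- them polynomials in the power sums.  Averaging over all permutations expresses
-- every symmetric polynomial through them, and as they vanish for r = n + 1 the
-- recursion also writes p_k, k > n, through smaller power sums.  Since
-- z_i = n^(i-1) p_i + (terms in p₁, …, p_{i-1}), this gives (iii).
--
-- D₋ is a derivation with D₋ p₁ = -n, and it kills z_i because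
-- n z_i = Σ_j (n x_j - p₁)^i.  Writing f ∈ Λₙ as Σ_k g_k p₁^k with g_k in ℚ[z₂,…,zₙ],
-- D₋ f = -n Σ_k k g_k p₁^(k-1); repeated differentiation shows that p₁ is
-- transcendental over the kernel, so D₋ f = 0 forces f = g₀, which is (i).
--
-- For (ii), let xᵃ have maximal degree d > 0 in x_i among the monomials of f: the
-- coefficient of x_i·xᵃ in D₊ f is d times that of xᵃ in f.
module Submission where

open import Algebra.Bundles using (CommutativeRing; Semiring)
open import Algebra.Bundles.Raw using (RawRing)
open import Algebra.Morphism.Structures using (module SemiringMorphisms)
import Algebra.Properties.CommutativeSemiring.Binomial
import Algebra.Properties.CommutativeSemiring.Exp
import Algebra.Properties.Ring
import Algebra.Properties.Semiring.Exp
import Algebra.Properties.Semiring.Mult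
import Algebra.Properties.Semiring.Sum
import Algebra.Solver.Ring.NaturalCoefficients.Default
open import Algebra.Structures using (IsCommutativeRing)
open import Data.Bool.Base using (if_then_else_)
open import Data.Fin.Base using (Fin; zero; suc; toℕ; punchIn)
open import Data.Fin.Permutation using (Permutation′; insert; _⟨$⟩ˡ_; _⟨$⟩ʳ_; inverseˡ; inverseʳ)
  renaming (id to idₚ)
open import Data.Fin.Properties using (toℕ-inject₁; toℕ-fromℕ; toℕ<n; punchInᵢ≢i; suc-injective)
  renaming (_≟_ to _≟ᶠ_)
open import Data.Integer.Base as ℤ using (ℤ; +_; -1ℤ)
import Data.Integer.Properties as ℤ
open import Data.Integer.Tactic.RingSolver using () renaming (solve-∀ to ℤ-solve-∀)
open import Data.List.Base as List using (List; []; _∷_; [_]; _++_; map; length; filter; cartesianProductWith)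
open import Data.List.Membership.Propositional using (_∈_)
open import Data.List.Membership.Propositional.Properties using (∈-map⁺; ∈-map⁻; ∈-applyUpTo⁺; ∈-applyUpTo⁻)
open import Data.List.Properties using
  (length-filter; length-removeAt; length-tabulate; length-%=; length-replicate; map-++)
open import Data.List.Relation.Unary.All using (All; []; _∷_)
import Data.List.Relation.Unary.All.Properties as All
open import Data.List.Relation.Unary.Any using (here; there)
open import Data.Nat.Base as ℕ using (ℕ; zero; suc; _≤_; _<_; s≤s; z≤n; _∸_; _⊔_; _!)
open import Data.Nat.Combinatorics using (_C_; nCn≡1; nC1≡n; nCk≡nC[n∸k])
open import Data.Nat.Induction using (<-rec)
open import Data.Nat.ListAction using () renaming (sum to sumℕ)
import Data.Nat.Properties as ℕ
open import Data.Nat.Properties using (_!≢0)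
open import Data.Product.Base using (_×_; _,_; proj₂; ∃; ∃-syntax)
open import Data.Rational.Base as ℚ using (ℚ; 0ℚ; 1ℚ)
import Data.Rational.Properties as ℚ
open import Data.Rational.Solver using (module +-*-Solver)
open import Data.Rational.Unnormalised.Base as ℚᵘ using (mkℚᵘ; *≡*)
import Data.Rational.Unnormalised.Properties as ℚᵘ
open import Data.Sum.Base using (_⊎_; inj₁; inj₂)
open import Function.Base using (_∘_; id)
open import Level using (0ℓ)
open import Relation.Binary.Definitions using (DecidableEquality)
open import Relation.Binary.PropositionalEquality as ≡ using (_≡_; _≢_)
import Relation.Binary.Reasoning.Setoid
open import Relation.Nullary using (does; yes; no; ¬?; contradiction)
open import Relation.Nullary.Decidable using (dec-true; dec-false)
open import Relation.Unary using (Pred; _≐_)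

open import Defs using (fromℤ)

-- Power sums and the `z_i` are treated in an arbitrary commutative ℚ-algebra with a tuple `x` of
-- elements: passing from `x` to `x ∘ suc` is then the induction on the number of variables, with no
-- embedding of one polynomial ring into another. Subalgebras are predicates, so the statement that
-- such a predicate contains all power sums is proved once and serves ℚ[p₁, z₂, ..., zₙ] in (iii) as
-- well as the polynomials in p₁ over ℚ[z₂, ..., zₙ] in (i). The power sums are only shown to
-- generate. Where algebraic independence might be expected, the derivation does the work, because
-- it sends p₁ to a nonzero constant. The origin of z_i: it is n^i times the i-th central moment of
-- x₁, ..., xₙ, hence invariant under a simultaneous translation of all variables, and -D₋ generates
-- these translations. On the concrete side the obstacle is that polynomials are lists of terms
-- compared by coefficients, so even multiplication does not visibly respect `_≈_`; pairing
-- polynomials with functions on monomials settles this for all operations.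

private variable n : ℕ

-- Augmented monomials and sums over permutations in a commutative ring

module AugmentedMonomials (R : CommutativeRing 0ℓ 0ℓ) where

  open CommutativeRing R hiding (zero)
  open Algebra.Properties.Semiring.Sum semiring using
    (sum; sum-cong-≋; sum-replicate; sum-replicate-zero; ∑-distrib-+; ∑-comm; *-distribˡ-sum)
  open Algebra.Properties.Semiring.Mult semiring using (×-congʳ; ×-assocˡ) renaming (_×_ to _·_)
  open Algebra.Properties.Semiring.Exp semiring using (_^_; ^-homo-*; ^-congʳ)
  open Algebra.Solver.Ring.NaturalCoefficients.Default commutativeSemiring using
    (solve; _:=_; _:+_; _:*_)
  open Relation.Binary.Reasoning.Setoid setoid

  powerSum : (Fin n → Carrier) → ℕ → Carrier
  powerSum x k = sum λ i → x i ^ k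

  Σpick : (as : List ℕ) → (ℕ → List ℕ → Carrier) → Carrier
  Σpick as F = sum λ j → F (List.lookup as j) (List.removeAt as j)

  Σbump : ℕ → (as : List ℕ) → (List ℕ → Carrier) → Carrier
  Σbump b as F = sum λ j → F (as List.[ j ]%= (ℕ._+ b))

  -- The sum of x_{t₁}^{a₁} ⋯ x_{tᵣ}^{aᵣ} over all injective tuples t, split
  -- according to which exponent, if any, is carried by the first variable.
  aug : (Fin n → Carrier) → List ℕ → Carrier
  aug {zero}  x []      = 1#
  aug {zero}  x (_ ∷ _) = 0#
  aug {suc n} x as      = aug (x ∘ suc) as + Σpick as λ a bs → x zero ^ a * aug (x ∘ suc) bs

  aug-[] : (x : Fin n → Carrier) → aug x [] ≈ 1#
  aug-[] {zero}  x = refl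
  aug-[] {suc n} x = trans (+-identityʳ _) (aug-[] (x ∘ suc))

  -- Pigeonhole: there is no injective tuple longer than n. When the first variable takes an
  -- exponent, list and variables both shrink by one, so the list stays too long.
  aug-long : (x : Fin n → Carrier) (as : List ℕ) → n < length as → aug x as ≈ 0#
  aug-long {zero}  x (_ ∷ _) _   = refl
  aug-long {suc n} x as      n<l = begin
    aug (x ∘ suc) as + Σpick as (λ a bs → x zero ^ a * aug (x ∘ suc) bs)
      ≈⟨ +-cong (aug-long (x ∘ suc) as (ℕ.<-trans (ℕ.n<1+n n) n<l)) (sum-cong-≋ {length as} λ j →
           trans (*-congˡ (aug-long (x ∘ suc) (List.removeAt as j) (shorter j))) (zeroʳ _)) ⟩
    0# + sum {length as} (λ _ → 0#)  ≈⟨ +-identityˡ _ ⟩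
    sum {length as} (λ _ → 0#)       ≈⟨ sum-replicate-zero (length as) ⟩
    0# ∎
    where
    shorter : ∀ j → n < length (List.removeAt as j)
    shorter j = ≡.subst (n <_) (≡.sym (length-removeAt as j)) (ℕ.pred-mono-≤ n<l)

  -- When one exponent is raised and one is picked, the two positions either differ, which gives the
  -- first sum, or coincide, which gives the second.
  Σpick-Σbump : ∀ b as (G : ℕ → List ℕ → Carrier) →
                Σpick as (λ a bs → Σbump b bs (G a)) + Σpick as (λ a bs → G (a ℕ.+ b) bs)
                ≈ Σbump b as (λ bs → Σpick bs G)
  Σpick-Σbump b []       G = +-identityˡ 0#
  Σpick-Σbump b (a ∷ as) G = begin
    (Σbump b as (G a) + Σpick as (λ c cs → G c (a ℕ.+ b ∷ cs) + Σbump b cs (G′ c)))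
      + (G (a ℕ.+ b) as + Σpick as (λ c cs → G′ (c ℕ.+ b) cs))
      ≈⟨ +-congʳ (+-congˡ (∑-distrib-+ {length as} _ _)) ⟩
    (Σbump b as (G a) + (Σpick as (λ c cs → G c (a ℕ.+ b ∷ cs)) + Σpick as (λ c cs → Σbump b cs (G′ c))))
      + (G (a ℕ.+ b) as + Σpick as (λ c cs → G′ (c ℕ.+ b) cs))
      ≈⟨ solve 5 (λ s t u v w → (s :+ (t :+ u)) :+ (v :+ w) := (v :+ t) :+ (s :+ (u :+ w))) refl _ _ _ _ _ ⟩
    Σpick (a ℕ.+ b ∷ as) G
      + (Σbump b as (G a) + (Σpick as (λ c cs → Σbump b cs (G′ c)) + Σpick as (λ c cs → G′ (c ℕ.+ b) cs)))
      ≈⟨ +-congˡ (+-congˡ (Σpick-Σbump b as G′)) ⟩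
    Σpick (a ℕ.+ b ∷ as) G + (Σbump b as (G a) + Σbump b as (λ bs → Σpick bs G′))
      ≈⟨ +-congˡ (∑-distrib-+ {length as} _ _) ⟨
    Σpick (a ℕ.+ b ∷ as) G + Σbump b as (λ bs → Σpick (a ∷ bs) G) ∎
    where
    G′ : ℕ → List ℕ → Carrier
    G′ c cs = G c (a ∷ cs)

  -- In a product of x_i^b with a term of aug x as, the variable x_i is either
  -- new or already carries one of the exponents.
  powerSum*aug : (x : Fin n → Carrier) (b : ℕ) (as : List ℕ) →
                 powerSum x b * aug x as ≈ aug x (b ∷ as) + Σbump b as (aug x)
  powerSum*aug {zero} x b as = trans (zeroˡ _) (sym (trans (+-identityˡ _) (nonempty as)))
    where
    nonempty : ∀ as → Σbump b as (aug x) ≈ 0#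
    nonempty as = trans (sum-cong-≋ {length as} λ j → reflexive (bumped as j))
      (sum-replicate-zero (length as))
      where
      bumped : ∀ as j → aug x (as List.[ j ]%= (ℕ._+ b)) ≡ 0#
      bumped (a ∷ as) zero    = ≡.refl
      bumped (a ∷ as) (suc j) = ≡.refl
  powerSum*aug {suc n} x b as = begin
    (y ^ b + p) * (A as + Σpick as G)
      ≈⟨ solve 4 (λ y p a s → (y :+ p) :* (a :+ s) := (p :* a :+ (y :* a :+ (y :* s :+ p :* s)))) refl _ _ _ _ ⟩
    p * A as + (y ^ b * A as + (y ^ b * Σpick as G + p * Σpick as G))
      -- The new exponent b belongs to the first variable or to a later one, and the first variable
      -- carries an old exponent or none. Only when it has both do they merge to `a ℕ.+ b`; a later
      -- variable is left to the induction hypothesis.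
      ≈⟨ +-cong (powerSum*aug (x ∘ suc) b as) (+-congˡ (+-cong pick-first pick-other)) ⟩
    (A (b ∷ as) + Σbump b as A)
      + (y ^ b * A as + (Σpick as (λ a bs → G (a ℕ.+ b) bs)
        + (Σpick as (λ a bs → y ^ a * A (b ∷ bs)) + Σpick as (λ a bs → Σbump b bs (G a)))))
      ≈⟨ solve 6 (λ s t u v w z → (s :+ t) :+ (u :+ (v :+ (w :+ z))) := (s :+ (u :+ w)) :+ (t :+ (z :+ v)))
           refl _ _ _ _ _ _ ⟩
    aug x (b ∷ as) + (Σbump b as A + (Σpick as (λ a bs → Σbump b bs (G a)) + Σpick as (λ a bs → G (a ℕ.+ b) bs)))
      ≈⟨ +-congˡ (+-congˡ (Σpick-Σbump b as G)) ⟩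
    aug x (b ∷ as) + (Σbump b as A + Σbump b as (λ bs → Σpick bs G))
      ≈⟨ +-congˡ (∑-distrib-+ {length as} _ _) ⟨
    aug x (b ∷ as) + Σbump b as (aug x) ∎
    where
    y = x zero
    p = powerSum (x ∘ suc) b
    A = aug (x ∘ suc)
    G : ℕ → List ℕ → Carrier
    G a bs = y ^ a * A bs
    pick-first : y ^ b * Σpick as G ≈ Σpick as (λ a bs → G (a ℕ.+ b) bs)
    pick-first = trans (*-distribˡ-sum {length as} (y ^ b) _) (sum-cong-≋ {length as} λ j →
      trans (sym (*-assoc _ _ _)) (*-congʳ (trans (*-comm _ _) (sym (^-homo-* y (List.lookup as j) b)))))
    pick-other : p * Σpick as G ≈ Σpick as (λ a bs → y ^ a * A (b ∷ bs)) + Σpick as (λ a bs → Σbump b bs (G a))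
    pick-other = trans (*-distribˡ-sum {length as} p _) (trans (sum-cong-≋ {length as} λ j → begin
        p * G (List.lookup as j) (List.removeAt as j)
          ≈⟨ solve 3 (λ p y a → p :* (y :* a) := y :* (p :* a)) refl _ _ _ ⟩
        y ^ List.lookup as j * (p * A (List.removeAt as j))
          ≈⟨ *-congˡ (powerSum*aug (x ∘ suc) b (List.removeAt as j)) ⟩
        y ^ List.lookup as j * (A (b ∷ List.removeAt as j) + Σbump b (List.removeAt as j) A)
          ≈⟨ distribˡ _ _ _ ⟩
        y ^ List.lookup as j * A (b ∷ List.removeAt as j) + y ^ List.lookup as j * Σbump b (List.removeAt as j) A
          ≈⟨ +-congˡ (*-distribˡ-sum {length (List.removeAt as j)} _ _) ⟩
        y ^ List.lookup as j * A (b ∷ List.removeAt as j) + Σbump b (List.removeAt as j) (G (List.lookup as j)) ∎)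
      (∑-distrib-+ {length as} _ _))

  mono : (Fin n → Carrier) → (Fin n → ℕ) → Carrier
  mono {zero}  x a = 1#
  mono {suc n} x a = x zero ^ a zero * mono (x ∘ suc) (a ∘ suc)

  -- A permutation is split into the preimage j of `zero` and a permutation of the remaining points.
  -- With this choice the exponent that `mono` puts on the first variable is `a j`, in step with the
  -- recursion of `aug`.
  Σperm : ∀ n → (Permutation′ n → Carrier) → Carrier
  Σperm zero    F = F idₚ
  Σperm (suc n) F = sum λ j → Σperm n λ π → F (insert j zero π)

  Σperm-cong : ∀ n {F G : Permutation′ n → Carrier} → (∀ π → F π ≈ G π) → Σperm n F ≈ Σperm n G
  Σperm-cong zero    h = h idₚ
  Σperm-cong (suc n) h = sum-cong-≋ λ j → Σperm-cong n λ π → h (insert j zero π)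

  Σperm-+ : ∀ n (F G : Permutation′ n → Carrier) → Σperm n (λ π → F π + G π) ≈ Σperm n F + Σperm n G
  Σperm-+ zero    F G = refl
  Σperm-+ (suc n) F G = trans
    (sum-cong-≋ {suc n} λ j → Σperm-+ n (λ π → F (insert j zero π)) (λ π → G (insert j zero π)))
    (∑-distrib-+ {suc n} (λ j → Σperm n λ π → F (insert j zero π)) (λ j → Σperm n λ π → G (insert j zero π)))

  Σperm-* : ∀ n y (F : Permutation′ n → Carrier) → Σperm n (λ π → y * F π) ≈ y * Σperm n F
  Σperm-* zero    y F = refl
  Σperm-* (suc n) y F = trans
    (sum-cong-≋ {suc n} λ j → Σperm-* n y λ π → F (insert j zero π))
    (sym (*-distribˡ-sum {suc n} y λ j → Σperm n λ π → F (insert j zero π)))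

  Σperm-const : ∀ n y → Σperm n (λ _ → y) ≈ (n !) · y
  Σperm-const zero    y = sym (+-identityʳ y)
  Σperm-const (suc n) y = begin
    sum {suc n} (λ _ → Σperm n (λ _ → y))  ≈⟨ sum-replicate (suc n) ⟩
    suc n · Σperm n (λ _ → y)              ≈⟨ ×-congʳ (suc n) (Σperm-const n y) ⟩
    suc n · ((n !) · y)                    ≈⟨ ×-assocˡ y (suc n) (n !) ⟩
    (suc n !) · y                          ∎

  Σpick-tabulate : (a : Fin (suc n) → ℕ) (F : ℕ → List ℕ → Carrier) →
                   Σpick (List.tabulate a) F ≈ sum λ j → F (a j) (List.tabulate (a ∘ punchIn j))
  Σpick-tabulate {zero}  a F = refl
  Σpick-tabulate {suc n} a F = +-congˡ (Σpick-tabulate (a ∘ suc) (λ c cs → F c (a zero ∷ cs)))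

  mono-cong : (x : Fin n → Carrier) {a b : Fin n → ℕ} → (∀ i → a i ≡ b i) → mono x a ≈ mono x b
  mono-cong {zero}  x h = refl
  mono-cong {suc n} x h = *-cong (^-congʳ (x zero) (h zero)) (mono-cong (x ∘ suc) (h ∘ suc))

  -- An injective assignment of n exponents to n variables is a bijection.
  Σperm-mono : (x : Fin n → Carrier) (a : Fin n → ℕ) →
               Σperm n (λ π → mono x (λ i → a (π ⟨$⟩ˡ i))) ≈ aug x (List.tabulate a)
  Σperm-mono {zero}  x a = refl
  Σperm-mono {suc n} x a = begin
    sum (λ j → Σperm n λ π → x zero ^ a j * mono (x ∘ suc) (λ i → a (punchIn j (π ⟨$⟩ˡ i))))
      ≈⟨ sum-cong-≋ (λ j → trans (Σperm-* n (x zero ^ a j) _) (*-congˡ (Σperm-mono (x ∘ suc) (a ∘ punchIn j)))) ⟩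
    sum (λ j → x zero ^ a j * aug (x ∘ suc) (List.tabulate (a ∘ punchIn j)))
      ≈⟨ Σpick-tabulate a (λ c cs → x zero ^ c * aug (x ∘ suc) cs) ⟨
    Σpick (List.tabulate a) (λ c cs → x zero ^ c * aug (x ∘ suc) cs)
      ≈⟨ +-identityˡ _ ⟨
    0# + Σpick (List.tabulate a) (λ c cs → x zero ^ c * aug (x ∘ suc) cs)
      -- The summand of `aug` in which the first variable carries no exponent vanishes: n + 1
      -- exponents do not fit on the n other variables.
      ≈⟨ +-congʳ (aug-long (x ∘ suc) (List.tabulate a) (≡.subst (n <_) (≡.sym (length-tabulate a)) (ℕ.n<1+n n))) ⟨
    aug x (List.tabulate a) ∎

-- Integers inside the rationals, and lists of exponents

fromℤ-+ : ∀ i j → fromℤ (i ℤ.+ j) ≡ fromℤ i ℚ.+ fromℤ j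
-- `fromℤ` normalises its fraction, so the identity is checked on unnormalised fractions.
fromℤ-+ i j = ℚ.toℚᵘ-injective (begin
  ℚ.toℚᵘ (fromℤ (i ℤ.+ j))                ≈⟨ ℚ.toℚᵘ-fromℚᵘ (mkℚᵘ (i ℤ.+ j) 0) ⟩
  mkℚᵘ (i ℤ.+ j) 0                        ≈⟨ *≡* (≡.cong₂ (λ k l → (k ℤ.+ l) ℤ.* + 1)
                                              (≡.sym (ℤ.*-identityʳ i)) (≡.sym (ℤ.*-identityʳ j))) ⟩
  mkℚᵘ i 0 ℚᵘ.+ mkℚᵘ j 0                  ≈⟨ ℚᵘ.+-cong (ℚ.toℚᵘ-fromℚᵘ (mkℚᵘ i 0)) (ℚ.toℚᵘ-fromℚᵘ (mkℚᵘ j 0)) ⟨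
  ℚ.toℚᵘ (fromℤ i) ℚᵘ.+ ℚ.toℚᵘ (fromℤ j)  ≈⟨ ℚ.toℚᵘ-homo-+ (fromℤ i) (fromℤ j) ⟨
  ℚ.toℚᵘ (fromℤ i ℚ.+ fromℤ j)            ∎)
  where open Relation.Binary.Reasoning.Setoid ℚᵘ.≃-setoid

fromℤ-* : ∀ i j → fromℤ (i ℤ.* j) ≡ fromℤ i ℚ.* fromℤ j
fromℤ-* i j = ℚ.toℚᵘ-injective (begin
  ℚ.toℚᵘ (fromℤ (i ℤ.* j))                ≈⟨ ℚ.toℚᵘ-fromℚᵘ (mkℚᵘ (i ℤ.* j) 0) ⟩
  mkℚᵘ i 0 ℚᵘ.* mkℚᵘ j 0                  ≈⟨ ℚᵘ.*-cong (ℚ.toℚᵘ-fromℚᵘ (mkℚᵘ i 0)) (ℚ.toℚᵘ-fromℚᵘ (mkℚᵘ j 0)) ⟨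
  ℚ.toℚᵘ (fromℤ i) ℚᵘ.* ℚ.toℚᵘ (fromℤ j)  ≈⟨ ℚ.toℚᵘ-homo-* (fromℤ i) (fromℤ j) ⟨
  ℚ.toℚᵘ (fromℤ i ℚ.* fromℤ j)            ∎)
  where open Relation.Binary.Reasoning.Setoid ℚᵘ.≃-setoid

fromℤ-≢0 : ∀ {i} → i ≢ + 0 → fromℤ i ≢ 0ℚ
fromℤ-≢0 {i} i≢0 eq with ℚᵘ.≃-trans (ℚᵘ.≃-sym (ℚ.toℚᵘ-fromℚᵘ (mkℚᵘ i 0))) (ℚᵘ.≃-reflexive (≡.cong ℚ.toℚᵘ eq))
... | *≡* i*1≡0 = i≢0 (≡.trans (≡.sym (ℤ.*-identityʳ i)) i*1≡0)

pos-^ : ∀ m k → + (m ℕ.^ k) ≡ (+ m) ℤ.^ k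
pos-^ m zero    = ≡.refl
pos-^ m (suc k) = ≡.trans (ℤ.pos-* m (m ℕ.^ k)) (≡.cong (+ m ℤ.*_) (pos-^ m k))

sumℕ-%= : ∀ b as j → sumℕ (as List.[ j ]%= (ℕ._+ b)) ≡ b ℕ.+ sumℕ as
sumℕ-%= b (a ∷ as) zero    = ≡.trans (≡.cong (ℕ._+ sumℕ as) (ℕ.+-comm a b)) (ℕ.+-assoc b a (sumℕ as))
sumℕ-%= b (a ∷ as) (suc j) = ≡.trans (≡.cong (a ℕ.+_) (sumℕ-%= b as j)) (≡.trans (≡.sym (ℕ.+-assoc a b (sumℕ as)))
  (≡.trans (≡.cong (ℕ._+ sumℕ as) (ℕ.+-comm a b)) (ℕ.+-assoc b a (sumℕ as))))

positive-%= : ∀ b {as} j → All (0 <_) as → All (0 <_) (as List.[ j ]%= (ℕ._+ b))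
positive-%= b zero    (0<a ∷ pos) = ℕ.≤-trans 0<a (ℕ.m≤m+n _ b) ∷ pos
positive-%= b (suc j) (0<a ∷ pos) = 0<a ∷ positive-%= b j pos

-- aug x as is a combination of products of power sums in which the single
-- power sum p_{|as|} has coefficient (-1)^(r-1) (r-1)!, where r is the length
-- of as; augWeight (r - 1) is minus this number.
augWeight : ℕ → ℤ
augWeight zero    = -1ℤ
augWeight (suc r) = (-1ℤ ℤ.* + suc r) ℤ.* augWeight r

augWeight-≢0 : ∀ r → augWeight r ≢ + 0
augWeight-≢0 zero ()
augWeight-≢0 (suc r) eq with ℤ.i*j≡0⇒i≡0∨j≡0 (-1ℤ ℤ.* + suc r) eq
... | inj₂ eq′ = augWeight-≢0 r eq′

zCoeff : ℕ → ℕ → ℕ → ℤ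
zCoeff n i k = -1ℤ ℤ.^ k ℤ.* + (n ℕ.^ (i ∸ k ∸ 1)) ℤ.* + (i C k)

-- Algebras over the rationals

module ℚ-Algebra
  (R : CommutativeRing 0ℓ 0ℓ) (ι : ℚ → CommutativeRing.Carrier R)
  (ι-hom : SemiringMorphisms.IsSemiringHomomorphism
    ℚ.+-*-rawSemiring (Semiring.rawSemiring (CommutativeRing.semiring R)) ι)
  where

  open CommutativeRing R hiding (zero)
  open SemiringMorphisms.IsSemiringHomomorphism ι-hom
  open AugmentedMonomials R
  open Algebra.Properties.Semiring.Sum semiring using
    (sum-cong-≋; sum-replicate; ∑-distrib-+; ∑-comm; *-distribˡ-sum; sum-init-last)
    renaming (sum to ∑)
  open Algebra.Properties.Semiring.Mult semiring using (×-cong) renaming (_×_ to _·_)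
  open Algebra.Properties.Semiring.Exp semiring using (_^_; ^-congˡ)
  open Algebra.Properties.CommutativeSemiring.Exp commutativeSemiring using (^-distrib-*)
  open Algebra.Properties.CommutativeSemiring.Binomial commutativeSemiring using ()
    renaming (theorem to binomial-theorem)
  open Algebra.Solver.Ring.NaturalCoefficients.Default commutativeSemiring using
    (solve; con; _:=_; _:+_; _:*_)
  open Relation.Binary.Reasoning.Setoid setoid

  ιℤ : ℤ → Carrier
  ιℤ i = ι (fromℤ i)

  ιℤ-+ : ∀ i j → ιℤ (i ℤ.+ j) ≈ ιℤ i + ιℤ j
  ιℤ-+ i j = trans (reflexive (≡.cong ι (fromℤ-+ i j))) (+-homo (fromℤ i) (fromℤ j))

  ιℤ-* : ∀ i j → ιℤ (i ℤ.* j) ≈ ιℤ i * ιℤ j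
  ιℤ-* i j = trans (reflexive (≡.cong ι (fromℤ-* i j))) (*-homo (fromℤ i) (fromℤ j))

  ιℤ-^ : ∀ i k → ιℤ (i ℤ.^ k) ≈ ιℤ i ^ k
  ιℤ-^ i zero    = 1#-homo
  ιℤ-^ i (suc k) = trans (ιℤ-* i (i ℤ.^ k)) (*-congˡ (ιℤ-^ i k))

  ·≈ιℤ* : ∀ k y → k · y ≈ ιℤ (+ k) * y
  ·≈ιℤ* zero    y = sym (trans (*-congʳ 0#-homo) (zeroˡ y))
  ·≈ιℤ* (suc k) y = begin
    y + k · y                  ≈⟨ +-cong (sym (*-identityˡ y)) (·≈ιℤ* k y) ⟩
    1# * y + ιℤ (+ k) * y      ≈⟨ distribʳ y 1# (ιℤ (+ k)) ⟨
    (1# + ιℤ (+ k)) * y        ≈⟨ *-congʳ (trans (ιℤ-+ (+ 1) (+ k)) (+-congʳ 1#-homo)) ⟨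
    ιℤ (+ suc k) * y           ∎

  -- Multiplication by the constant `ιℤ -1ℤ` plays the role of negation: subalgebras are thereby
  -- closed under differences, and regrouping stays within reach of a semiring solver.
  -1*x+x≈0 : ∀ y → ιℤ -1ℤ * y + y ≈ 0#
  -1*x+x≈0 y = begin
    ιℤ -1ℤ * y + y             ≈⟨ +-congˡ (trans (*-congʳ 1#-homo) (*-identityˡ y)) ⟨
    ιℤ -1ℤ * y + ιℤ (+ 1) * y  ≈⟨ distribʳ y (ιℤ -1ℤ) (ιℤ (+ 1)) ⟨
    (ιℤ -1ℤ + ιℤ (+ 1)) * y    ≈⟨ *-congʳ (ιℤ-+ -1ℤ (+ 1)) ⟨
    ιℤ (+ 0) * y               ≈⟨ *-congʳ 0#-homo ⟩
    0# * y                     ≈⟨ zeroˡ y ⟩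
    0#                         ∎

  inverse : ∀ {i} → i ≢ + 0 → ∃[ q ] ∀ y → ι q * (ιℤ i * y) ≈ y
  inverse {i} i≢0 = ℚ.1/ fromℤ i , λ y → begin
    ι (ℚ.1/ fromℤ i) * (ιℤ i * y)   ≈⟨ *-assoc _ _ y ⟨
    (ι (ℚ.1/ fromℤ i) * ιℤ i) * y   ≈⟨ *-congʳ (*-homo (ℚ.1/ fromℤ i) (fromℤ i)) ⟨
    ι (ℚ.1/ fromℤ i ℚ.* fromℤ i) * y ≈⟨ *-congʳ (reflexive (≡.cong ι (ℚ.*-inverseˡ (fromℤ i)))) ⟩
    ι 1ℚ * y                        ≈⟨ *-congʳ 1#-homo ⟩
    1# * y                          ≈⟨ *-identityˡ y ⟩
    y                               ∎
    where instance _ = ℚ.≢-nonZero (fromℤ-≢0 i≢0)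

  ιℤ-cancel : ∀ {i y} → i ≢ + 0 → ιℤ i * y ≈ 0# → y ≈ 0#
  ιℤ-cancel {y = y} i≢0 iy≈0 with q , q-inverse ← inverse i≢0 =
    trans (sym (q-inverse y)) (trans (*-congˡ iy≈0) (zeroʳ (ι q)))

  -- Subalgebras and the power sums they contain

  record IsSubalgebra (P : Pred Carrier 0ℓ) : Set where
    field
      ι-closed : ∀ q → P (ι q)
      +-closed : ∀ {x y} → P x → P y → P (x + y)
      *-closed : ∀ {x y} → P x → P y → P (x * y)
      ≈-closed : ∀ {x y} → x ≈ y → P x → P y

    0∈ : P 0#
    0∈ = ≈-closed 0#-homo (ι-closed 0ℚ)

    1∈ : P 1#
    1∈ = ≈-closed 1#-homo (ι-closed 1ℚ)

    ^∈ : ∀ {x} k → P x → P (x ^ k)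
    ^∈ zero    x∈ = 1∈
    ^∈ (suc k) x∈ = *-closed x∈ (^∈ k x∈)

    ∑∈ : {t : Fin n → Carrier} → (∀ i → P (t i)) → P (∑ t)
    ∑∈ {n = zero}  t∈ = 0∈
    ∑∈ {n = suc n} t∈ = +-closed (t∈ zero) (∑∈ (t∈ ∘ suc))

    +∈⁻ : ∀ {x y} → P (x + y) → P y → P x
    +∈⁻ {x} {y} x+y∈ y∈ = ≈-closed (begin
      (x + y) + ιℤ -1ℤ * y  ≈⟨ +-assoc x y _ ⟩
      x + (y + ιℤ -1ℤ * y)  ≈⟨ +-congˡ (trans (+-comm y _) (-1*x+x≈0 y)) ⟩
      x + 0#                ≈⟨ +-identityʳ x ⟩
      x                     ∎) (+-closed x+y∈ (*-closed (ι-closed _) y∈))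

    ιℤ*∈⁻ : ∀ {i y} → i ≢ + 0 → P (ιℤ i * y) → P y
    ιℤ*∈⁻ {y = y} i≢0 iy∈ with q , q-inverse ← inverse i≢0 = ≈-closed (q-inverse y) (*-closed (ι-closed q) iy∈)

  powerSum-0 : (x : Fin n → Carrier) → powerSum x 0 ≈ ιℤ (+ n)
  powerSum-0 {n} x = trans (sum-replicate n) (trans (·≈ιℤ* n 1#) (*-identityʳ _))

  module _ (x : Fin n → Carrier) {P : Pred Carrier 0ℓ} (sub : IsSubalgebra P) where
    open IsSubalgebra sub

    -- `powerSum*aug` trades b ∷ as for shorter lists. The length r is a separate argument because
    -- the lists with a raised exponent are not subterms; raising an entry by b keeps the total, so
    -- the bound on the power sums persists.
    aug∈ : ∀ r as → length as ≡ r → (∀ k → k ≤ sumℕ as → P (powerSum x k)) → P (aug x as)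
    aug∈ r       []       len p∈ = ≈-closed (sym (aug-[] x)) 1∈
    aug∈ (suc r) (b ∷ as) len p∈ = +∈⁻
      (≈-closed (powerSum*aug x b as) (*-closed (p∈ b (ℕ.m≤m+n b (sumℕ as)))
        (aug∈ r as (ℕ.suc-injective len) λ k k≤ → p∈ k (ℕ.≤-trans k≤ (ℕ.m≤n+m (sumℕ as) b)))))
      (∑∈ {n = length as} λ j → aug∈ r (as List.[ j ]%= (ℕ._+ b))
        (≡.trans (length-%= as j (ℕ._+ b)) (ℕ.suc-injective len))
        (λ k k≤ → p∈ k (≡.subst (k ≤_) (sumℕ-%= b as j) k≤)))

    -- Modulo P only the top power sum p_N, with N the sum of the exponents, is unknown. Positivity
    -- makes b and the sum of the other exponents both smaller than N, so the product
    -- `powerSum x b * aug x as` lies in P, while every list with a raised exponent again has total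
    -- N.
    aug+powerSum∈ : ∀ r as → length as ≡ suc r → All (0 <_) as → (∀ k → k < sumℕ as → P (powerSum x k)) →
                    P (aug x as + ιℤ (augWeight r) * powerSum x (sumℕ as))
    aug+powerSum∈ zero (b ∷ []) len pos p∈ = ≈-closed (sym (begin
      aug x (b ∷ []) + ιℤ -1ℤ * powerSum x (b ℕ.+ 0)
        ≈⟨ +-cong (trans (sym (+-identityʳ _)) (trans (sym (powerSum*aug x b []))
             (trans (*-congˡ (aug-[] x)) (*-identityʳ _))))
             (*-congˡ (reflexive (≡.cong (powerSum x) (ℕ.+-identityʳ b)))) ⟩
      powerSum x b + ιℤ -1ℤ * powerSum x b  ≈⟨ +-comm _ _ ⟩
      ιℤ -1ℤ * powerSum x b + powerSum x b  ≈⟨ -1*x+x≈0 _ ⟩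
      0#                                    ∎)) 0∈
    aug+powerSum∈ (suc r) (b ∷ as@(a ∷ _)) len (0<b ∷ pos@(0<a ∷ _)) p∈ = +∈⁻
      (≈-closed regroup product∈)
      (∑∈ {n = length as} λ j → ≈-closed (+-congˡ (*-congˡ (reflexive (≡.cong (powerSum x) (sumℕ-%= b as j)))))
        (aug+powerSum∈ r (as List.[ j ]%= (ℕ._+ b)) (≡.trans (length-%= as j (ℕ._+ b)) len′) (positive-%= b j pos)
          (λ k k< → p∈ k (≡.subst (k <_) (sumℕ-%= b as j) k<))))
      where
      len′ : length as ≡ suc r
      len′ = ℕ.suc-injective len
      N = b ℕ.+ sumℕ as
      w = ιℤ (augWeight r) * powerSum x N
      w′ = ιℤ (augWeight (suc r)) * powerSum x N
      product∈ : P (powerSum x b * aug x as)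
      product∈ = *-closed (p∈ b (ℕ.m<m+n b (ℕ.≤-trans 0<a (ℕ.m≤m+n a _))))
        (aug∈ (suc r) as len′ λ k k≤ → p∈ k (ℕ.≤-<-trans k≤ (ℕ.m<n+m (sumℕ as) 0<b)))
      -- Each of the r + 1 positions that b can be added to contributes w; the factor -(r + 1) in
      -- `augWeight` cancels them.
      weights : w′ + suc r · w ≈ 0#
      weights = begin
        w′ + suc r · w
          ≈⟨ +-cong (*-congʳ (trans (ιℤ-* (-1ℤ ℤ.* + suc r) (augWeight r)) (*-congʳ (ιℤ-* -1ℤ (+ suc r)))))
               (·≈ιℤ* (suc r) w) ⟩
        ((ιℤ -1ℤ * ιℤ (+ suc r)) * ιℤ (augWeight r)) * powerSum x N + ιℤ (+ suc r) * w
          ≈⟨ +-congʳ (solve 4 (λ a b c d → ((a :* b) :* c) :* d := a :* (b :* (c :* d))) refl _ _ _ _) ⟩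
        ιℤ -1ℤ * (ιℤ (+ suc r) * w) + ιℤ (+ suc r) * w  ≈⟨ -1*x+x≈0 _ ⟩
        0# ∎
      regroup : powerSum x b * aug x as
                ≈ (aug x (b ∷ as) + w′) + Σbump b as (λ bs → aug x bs + w)
      regroup = begin
        powerSum x b * aug x as                          ≈⟨ powerSum*aug x b as ⟩
        aug x (b ∷ as) + Σbump b as (aug x)              ≈⟨ +-identityʳ _ ⟨
        (aug x (b ∷ as) + Σbump b as (aug x)) + 0#       ≈⟨ +-congˡ weights ⟨
        (aug x (b ∷ as) + Σbump b as (aug x)) + (w′ + suc r · w)
          ≈⟨ solve 4 (λ a s u v → (a :+ s) :+ (u :+ v) := (a :+ u) :+ (s :+ v)) refl _ _ _ _ ⟩
        (aug x (b ∷ as) + w′) + (Σbump b as (aug x) + suc r · w)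
          ≈⟨ +-congˡ (+-congˡ (×-cong len′ refl)) ⟨
        (aug x (b ∷ as) + w′) + (Σbump b as (aug x) + length as · w)
          ≈⟨ +-congˡ (+-congˡ (sum-replicate (length as))) ⟨
        (aug x (b ∷ as) + w′) + (Σbump b as (aug x) + Σbump b as (λ _ → w))
          ≈⟨ +-congˡ (∑-distrib-+ {length as} (λ j → aug x (as List.[ j ]%= (ℕ._+ b))) (λ _ → w)) ⟨
        (aug x (b ∷ as) + w′) + Σbump b as (λ bs → aug x bs + w) ∎

    -- In n variables every aug x as with n + 1 exponents vanishes.
    powerSum-large∈ : ∀ k → n < k → (∀ j → j < k → P (powerSum x j)) → P (powerSum x k)
    powerSum-large∈ k n<k p∈ = ιℤ*∈⁻ (augWeight-≢0 n)
      (≈-closed (trans (+-cong (aug-long x as (ℕ.≤-reflexive (≡.sym len)))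
                         (*-congˡ (reflexive (≡.cong (powerSum x) total)))) (+-identityˡ _))
        (aug+powerSum∈ n as len (ℕ.m<n⇒0<n∸m n<k ∷ All.replicate⁺ n (s≤s z≤n))
          (λ j j< → p∈ j (≡.subst (j <_) total j<))))
      where
      -- A list of n + 1 positive exponents with sum k; its first entry is positive because k > n.
      as : List ℕ
      as = k ∸ n ∷ List.replicate n 1
      len : length as ≡ suc n
      len = ≡.cong suc (length-replicate n)
      sum-ones : ∀ m → sumℕ (List.replicate m 1) ≡ m
      sum-ones zero    = ≡.refl
      sum-ones (suc m) = ≡.cong suc (sum-ones m)
      total : sumℕ as ≡ k
      total = ≡.trans (≡.cong (k ∸ n ℕ.+_) (sum-ones n)) (ℕ.m∸n+n≡m (ℕ.<⇒≤ n<k))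

  -- Derivations

  record IsDerivation (D : Carrier → Carrier) : Set where
    field
      D-cong : ∀ {x y} → x ≈ y → D x ≈ D y
      D-+    : ∀ x y → D (x + y) ≈ D x + D y
      D-*    : ∀ x y → D (x * y) ≈ D x * y + x * D y
      D-ι    : ∀ q → D (ι q) ≈ 0#

    D-0 : D 0# ≈ 0#
    D-0 = trans (D-cong (sym 0#-homo)) (D-ι 0ℚ)

    D-ι* : ∀ q x → D (ι q * x) ≈ ι q * D x
    D-ι* q x = trans (D-* (ι q) x) (trans (+-congʳ (trans (*-congʳ (D-ι q)) (zeroˡ x))) (+-identityˡ _))

    D-∑ : (t : Fin n → Carrier) → D (∑ t) ≈ ∑ (D ∘ t)
    D-∑ {n = zero}  t = D-0
    D-∑ {n = suc n} t = trans (D-+ (t zero) (∑ (t ∘ suc))) (+-congˡ (D-∑ (t ∘ suc)))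

    kernel : IsSubalgebra (λ y → D y ≈ 0#)
    kernel = record
      { ι-closed = D-ι
      ; +-closed = λ {x} {y} Dx≈0 Dy≈0 → trans (D-+ x y) (trans (+-cong Dx≈0 Dy≈0) (+-identityˡ 0#))
      ; *-closed = λ {x} {y} Dx≈0 Dy≈0 → trans (D-* x y) (trans
          (+-cong (trans (*-congʳ Dx≈0) (zeroˡ y)) (trans (*-congˡ Dy≈0) (zeroʳ x))) (+-identityˡ 0#))
      ; ≈-closed = λ x≈y Dx≈0 → trans (D-cong (sym x≈y)) Dx≈0
      }

  -- Polynomials in one element over a subalgebra

  horner : Carrier → List Carrier → Carrier
  horner t []       = 0#
  horner t (g ∷ gs) = g + t * horner t gs

  module _ (t : Carrier) {Q : Pred Carrier 0ℓ} (sub : IsSubalgebra Q) where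
    open IsSubalgebra sub

    Adjoin : Pred Carrier 0ℓ
    Adjoin f = ∃[ gs ] All Q gs × f ≈ horner t gs

    private

      addH : ∀ {gs hs} → All Q gs → All Q hs → Adjoin (horner t gs + horner t hs)
      addH {hs = hs} [] hs∈ = hs , hs∈ , +-identityˡ _
      addH {gs} gs∈@(_ ∷ _) [] = gs , gs∈ , +-identityʳ _
      addH (g∈ ∷ gs∈) (h∈ ∷ hs∈) with ks , ks∈ , eq ← addH gs∈ hs∈ =
        _ ∷ ks , +-closed g∈ h∈ ∷ ks∈ , trans
          (solve 5 (λ g u h v t → (g :+ t :* u) :+ (h :+ t :* v) := (g :+ h) :+ t :* (u :+ v)) refl _ _ _ _ _)
          (+-congˡ (*-congˡ eq))

      scaleH : ∀ {q gs} → Q q → All Q gs → Adjoin (q * horner t gs)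
      scaleH q∈ [] = [] , [] , zeroʳ _
      scaleH q∈ (g∈ ∷ gs∈) with ks , ks∈ , eq ← scaleH q∈ gs∈ =
        _ ∷ ks , *-closed q∈ g∈ ∷ ks∈ , trans
          (solve 4 (λ q g t u → q :* (g :+ t :* u) := q :* g :+ t :* (q :* u)) refl _ _ _ _)
          (+-congˡ (*-congˡ eq))

      mulH : ∀ {gs hs} → All Q gs → All Q hs → Adjoin (horner t gs * horner t hs)
      mulH [] hs∈ = [] , [] , zeroˡ _
      mulH (g∈ ∷ gs∈) hs∈ with ks , ks∈ , eq ← scaleH g∈ hs∈ | ls , ls∈ , eq′ ← mulH gs∈ hs∈
        -- Prepending `0#` to a coefficient list multiplies its value by t.
        with ms , ms∈ , eq″ ← addH ks∈ (0∈ ∷ ls∈) = ms , ms∈ , trans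
          (solve 4 (λ g t u h → (g :+ t :* u) :* h := g :* h :+ t :* (u :* h)) refl _ _ _ _)
          (trans (+-cong eq (trans (*-congˡ eq′) (sym (+-identityˡ _)))) eq″)

    coefficient∈ : ∀ {g} → Q g → Adjoin g
    coefficient∈ {g} g∈ = g ∷ [] , g∈ ∷ [] , sym (trans (+-congˡ (zeroʳ t)) (+-identityʳ g))

    adjoin : IsSubalgebra Adjoin
    adjoin = record
      { ι-closed = λ q → coefficient∈ (ι-closed q)
      ; +-closed = λ (_ , gs∈ , eq) (_ , hs∈ , eq′) → let ks , ks∈ , eq″ = addH gs∈ hs∈ in
          ks , ks∈ , trans (+-cong eq eq′) eq″
      ; *-closed = λ (_ , gs∈ , eq) (_ , hs∈ , eq′) → let ks , ks∈ , eq″ = mulH gs∈ hs∈ in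
          ks , ks∈ , trans (*-cong eq eq′) eq″
      ; ≈-closed = λ x≈y (gs , gs∈ , eq) → gs , gs∈ , trans (sym x≈y) eq
      }

    indeterminate∈ : Adjoin t
    indeterminate∈ = 0# ∷ 1# ∷ [] , 0∈ ∷ 1∈ ∷ [] , sym (trans (+-identityˡ _) (trans
      (*-congˡ (trans (+-congˡ (zeroʳ t)) (+-identityʳ 1#))) (*-identityʳ t)))

    module _ {D : Carrier → Carrier} (der : IsDerivation D) {κ : ℤ} (κ≢0 : κ ≢ + 0) (Dt≈κ : D t ≈ ιℤ κ)
             (constants : ∀ {g} → Q g → D g ≈ 0#) where
      open IsDerivation der

      -- If gs = g₀, g₁, … then horner t (weighted k gs) = Σ_j (k + j) g_j t^j.
      weighted : ℕ → List Carrier → List Carrier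
      weighted k []       = []
      weighted k (g ∷ gs) = ιℤ (+ k) * g ∷ weighted (suc k) gs

      weighted∈ : ∀ k {gs} → All Q gs → All Q (weighted k gs)
      weighted∈ k []          = []
      weighted∈ k (g∈ ∷ gs∈) = *-closed (ι-closed _) g∈ ∷ weighted∈ (suc k) gs∈

      length-weighted : ∀ k gs → length (weighted k gs) ≡ length gs
      length-weighted k []       = ≡.refl
      length-weighted k (g ∷ gs) = ≡.cong suc (length-weighted (suc k) gs)

      unweight : ∀ k gs → All (_≈ 0#) (weighted (suc k) gs) → All (_≈ 0#) gs
      unweight k []       []          = []
      unweight k (g ∷ gs) (eq ∷ eqs) = ιℤ-cancel {+ suc k} (λ ()) eq ∷ unweight (suc k) gs eqs

      horner-0 : ∀ {gs} → All (_≈ 0#) gs → horner t gs ≈ 0#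
      horner-0 []         = refl
      horner-0 (eq ∷ eqs) = trans (+-cong eq (trans (*-congˡ (horner-0 eqs)) (zeroʳ t))) (+-identityˡ 0#)

      D-∷ : ∀ {g} gs → Q g → D (horner t (g ∷ gs)) ≈ ιℤ κ * horner t gs + t * D (horner t gs)
      D-∷ {g} gs g∈ = begin
        D (g + t * horner t gs)                              ≈⟨ D-+ _ _ ⟩
        D g + D (t * horner t gs)                            ≈⟨ +-cong (constants g∈) (D-* _ _) ⟩
        0# + (D t * horner t gs + t * D (horner t gs))       ≈⟨ +-identityˡ _ ⟩
        D t * horner t gs + t * D (horner t gs)              ≈⟨ +-congʳ (*-congʳ Dt≈κ) ⟩
        ιℤ κ * horner t gs + t * D (horner t gs)             ∎

      -- With h = `horner t gs`, the left side is D (t^k h) with the factor t^(k-1) removed.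
      -- Carrying k along lets the induction walk down the list without powers of t; k = 1 gives κ
      -- times the formal derivative of t h.
      D-weighted : ∀ k {gs} → All Q gs →
                   (ιℤ (+ k) * ιℤ κ) * horner t gs + t * D (horner t gs) ≈ ιℤ κ * horner t (weighted k gs)
      D-weighted k [] = trans (+-cong (zeroʳ _) (trans (*-congˡ D-0) (zeroʳ t)))
        (trans (+-identityˡ 0#) (sym (zeroʳ _)))
      D-weighted k {g ∷ gs} (g∈ ∷ gs∈) = begin
        (ιℤ (+ k) * ιℤ κ) * (g + t * h) + t * D (horner t (g ∷ gs))
          ≈⟨ +-congˡ (*-congˡ (D-∷ gs g∈)) ⟩
        (ιℤ (+ k) * ιℤ κ) * (g + t * h) + t * (ιℤ κ * h + t * D h)
          ≈⟨ solve 6 (λ k c g t h d → (k :* c) :* (g :+ t :* h) :+ t :* (c :* h :+ t :* d)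
                     := c :* (k :* g) :+ t :* (((con 1 :+ k) :* c) :* h :+ t :* d)) refl _ _ _ _ _ _ ⟩
        ιℤ κ * (ιℤ (+ k) * g) + t * (((1# + ιℤ (+ k)) * ιℤ κ) * h + t * D h)
          ≈⟨ +-congˡ (*-congˡ (+-congʳ (*-congʳ (*-congʳ
               (trans (ιℤ-+ (+ 1) (+ k)) (+-congʳ 1#-homo)))))) ⟨
        ιℤ κ * (ιℤ (+ k) * g) + t * ((ιℤ (+ suc k) * ιℤ κ) * h + t * D h)
          ≈⟨ +-congˡ (*-congˡ (D-weighted (suc k) gs∈)) ⟩
        ιℤ κ * (ιℤ (+ k) * g) + t * (ιℤ κ * horner t (weighted (suc k) gs))
          ≈⟨ solve 4 (λ c g t h → c :* g :+ t :* (c :* h) := c :* (g :+ t :* h)) refl _ _ _ _ ⟩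
        ιℤ κ * horner t (weighted k (g ∷ gs)) ∎
        where h = horner t gs

      horner-weighted-1 : ∀ {g gs} → Q g → All Q gs →
                          D (horner t (g ∷ gs)) ≈ 0# → horner t (weighted 1 gs) ≈ 0#
      horner-weighted-1 {g} {gs} g∈ gs∈ D≈0 = ιℤ-cancel κ≢0 (begin
        ιℤ κ * horner t (weighted 1 gs)                          ≈⟨ D-weighted 1 gs∈ ⟨
        (ιℤ (+ 1) * ιℤ κ) * horner t gs + t * D (horner t gs)
          ≈⟨ +-congʳ (*-congʳ (trans (*-congʳ 1#-homo) (*-identityˡ _))) ⟩
        ιℤ κ * horner t gs + t * D (horner t gs)                 ≈⟨ D-∷ gs g∈ ⟨
        D (horner t (g ∷ gs))                                    ≈⟨ D≈0 ⟩
        0#                                                       ∎)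

      -- Differentiating a relation removes g₀ and multiplies g_j by the nonzero integer j, up to
      -- the factor κ. The shorter relation kills g₁, g₂, ... by induction, and then g₀ is all that
      -- remains. The length k is explicit because the weighted list is not a subterm.
      horner-injective : ∀ k {gs} → length gs ≡ k → All Q gs → horner t gs ≈ 0# → All (_≈ 0#) gs
      horner-injective k       {[]}      _   []          _  = []
      horner-injective (suc k) {g ∷ gs} len (g∈ ∷ gs∈) eq =
        trans (sym (trans (+-congˡ (trans (*-congˡ (horner-0 gs≈0)) (zeroʳ t))) (+-identityʳ g))) eq ∷ gs≈0
        where
        gs≈0 : All (_≈ 0#) gs
        gs≈0 = unweight 0 gs (horner-injective k
          (≡.trans (length-weighted 1 gs) (ℕ.suc-injective len)) (weighted∈ 1 gs∈)
          (horner-weighted-1 g∈ gs∈ (trans (D-cong eq) D-0)))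

      adjoin-kernel : ∀ {f} → Adjoin f → D f ≈ 0# → Q f
      adjoin-kernel ([] , [] , eq) Df≈0 = ≈-closed (sym eq) 0∈
      adjoin-kernel (g ∷ gs , g∈ ∷ gs∈ , eq) Df≈0 = ≈-closed (sym (trans eq
        (trans (+-congˡ (trans (*-congˡ (horner-0 gs≈0)) (zeroʳ t))) (+-identityʳ g)))) g∈
        where
        gs≈0 : All (_≈ 0#) gs
        gs≈0 = unweight 0 gs (horner-injective _ ≡.refl (weighted∈ 1 gs∈)
          (horner-weighted-1 g∈ gs∈ (trans (D-cong (sym eq)) Df≈0)))

  -- The elements z_i as sums of powers of n x_j - p₁

  zᴿ : (Fin n → Carrier) → ℕ → Carrier
  zᴿ {n} x i = ∑ (λ (κ : Fin (i ∸ 1)) →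
                  ιℤ (zCoeff n i (toℕ κ)) * powerSum x (i ∸ toℕ κ) * powerSum x 1 ^ toℕ κ)
              + ιℤ (+ (i ∸ 1) ℤ.* -1ℤ ℤ.^ (i ℕ.+ 1)) * powerSum x 1 ^ i

  z∈ : (x : Fin n → Carrier) {P : Pred Carrier 0ℓ} → IsSubalgebra P → (∀ k → P (powerSum x k)) → ∀ i → P (zᴿ x i)
  z∈ x sub p∈ i = +-closed
    (∑∈ {n = i ∸ 1} λ κ → *-closed (*-closed (ι-closed _) (p∈ (i ∸ toℕ κ))) (^∈ (toℕ κ) (p∈ 1)))
    (*-closed (ι-closed _) (^∈ i (p∈ 1)))
    where open IsSubalgebra sub

  ∑-toℕ-last : ∀ (S : ℕ → Carrier) m → ∑ {suc m} (S ∘ toℕ) ≈ ∑ {m} (S ∘ toℕ) + S m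
  ∑-toℕ-last S m = trans (sum-init-last (S ∘ toℕ)) (+-cong
    (sum-cong-≋ {m} λ κ → reflexive (≡.cong S (toℕ-inject₁ κ)))
    (reflexive (≡.cong S (toℕ-fromℕ m))))

  -- This is n times the deviation of x_j from the mean p₁/n, so its powers sum to multiples of the
  -- central moments.
  shifted : (Fin n → Carrier) → Fin n → Carrier
  shifted {n} x j = ιℤ -1ℤ * powerSum x 1 + ιℤ (+ n) * x j

  -- Binomial expansion of Σ_j (n x_j - p₁)^i: up to the factor n, its last two
  -- terms combine to the p₁^i term of z_i.
  n*z : (x : Fin n → Carrier) (m : ℕ) → let i = suc (suc m) in
        ιℤ (+ n) * zᴿ x i ≈ ∑ (λ j → shifted x j ^ i)
  n*z {n} x m = sym (begin
    ∑ (λ j → shifted x j ^ i)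
      ≈⟨ sum-cong-≋ (λ j → trans (binomial-theorem i _ _)
           (sum-cong-≋ {suc i} λ κ → term j (toℕ κ))) ⟩
    ∑ (λ j → ∑ {suc i} λ κ → T (toℕ κ) * x j ^ (i ∸ toℕ κ))
      ≈⟨ ∑-comm {n} {suc i} (λ j κ → T (toℕ κ) * x j ^ (i ∸ toℕ κ)) ⟩
    ∑ {suc i} (λ κ → ∑ λ j → T (toℕ κ) * x j ^ (i ∸ toℕ κ))
      ≈⟨ sum-cong-≋ {suc i} (λ κ → *-distribˡ-sum (T (toℕ κ)) (λ j → x j ^ (i ∸ toℕ κ))) ⟨
    ∑ {suc i} (S ∘ toℕ)                          ≈⟨ ∑-toℕ-last S i ⟩
    ∑ {i} (S ∘ toℕ) + S i                        ≈⟨ +-congʳ (∑-toℕ-last S (suc m)) ⟩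
    (∑ {suc m} (S ∘ toℕ) + S (suc m)) + S i      ≈⟨ +-assoc _ _ _ ⟩
    ∑ {suc m} (S ∘ toℕ) + (S (suc m) + S i)
      ≈⟨ +-cong (sum-cong-≋ {suc m} λ κ → leading (toℕ κ) (ℕ.≤-pred (toℕ<n κ))) last-two ⟩
    ∑ {suc m} (λ κ → ν * Z (toℕ κ)) + ν * zₗ     ≈⟨ +-congʳ (*-distribˡ-sum {suc m} ν (Z ∘ toℕ)) ⟨
    ν * ∑ {suc m} (Z ∘ toℕ) + ν * zₗ             ≈⟨ distribˡ _ _ _ ⟨
    ν * zᴿ x i                                    ∎)
    where
    i = suc (suc m)
    ν = ιℤ (+ n)
    p = powerSum x
    c : ℕ → ℤ
    c k = -1ℤ ℤ.^ k ℤ.* + (n ℕ.^ (i ∸ k)) ℤ.* + (i C k)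
    T S Z : ℕ → Carrier
    T k = ιℤ (c k) * p 1 ^ k
    S k = T k * p (i ∸ k)
    Z k = ιℤ (zCoeff n i k) * p (i ∸ k) * p 1 ^ k
    zₗ = ιℤ (+ suc m ℤ.* -1ℤ ℤ.^ (i ℕ.+ 1)) * p 1 ^ i

    term : ∀ j k → (i C k) · ((ιℤ -1ℤ * p 1) ^ k * (ν * x j) ^ (i ∸ k)) ≈ T k * x j ^ (i ∸ k)
    term j k = begin
      (i C k) · ((ιℤ -1ℤ * p 1) ^ k * (ν * x j) ^ (i ∸ k))
        ≈⟨ ·≈ιℤ* (i C k) _ ⟩
      ιℤ (+ (i C k)) * ((ιℤ -1ℤ * p 1) ^ k * (ν * x j) ^ (i ∸ k))
        ≈⟨ *-congˡ (*-cong (^-distrib-* _ _ k) (^-distrib-* _ _ (i ∸ k))) ⟩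
      ιℤ (+ (i C k)) * ((ιℤ -1ℤ ^ k * p 1 ^ k) * (ν ^ (i ∸ k) * x j ^ (i ∸ k)))
        ≈⟨ solve 5 (λ a b q d y → a :* ((b :* q) :* (d :* y)) := (((b :* d) :* a) :* q) :* y) refl _ _ _ _ _ ⟩
      (((ιℤ -1ℤ ^ k * ν ^ (i ∸ k)) * ιℤ (+ (i C k))) * p 1 ^ k) * x j ^ (i ∸ k)
        ≈⟨ *-congʳ (*-congʳ (trans (ιℤ-* (-1ℤ ℤ.^ k ℤ.* + (n ℕ.^ (i ∸ k))) (+ (i C k)))
             (*-congʳ (trans (ιℤ-* (-1ℤ ℤ.^ k) (+ (n ℕ.^ (i ∸ k))))
             (*-cong (ιℤ-^ -1ℤ k) (trans (reflexive (≡.cong ιℤ (pos-^ n (i ∸ k)))) (ιℤ-^ (+ n) (i ∸ k)))))))) ⟨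
      T k * x j ^ (i ∸ k) ∎

    -- As k < i, one factor n splits off n^(i-k) and leaves the exponent i - k - 1 of `zCoeff`.
    leading : ∀ k → k ≤ m → S k ≈ ν * Z k
    leading k k≤m = begin
      (ιℤ (c k) * p 1 ^ k) * p (i ∸ k)
        ≈⟨ *-congʳ (*-congʳ (trans (reflexive (≡.cong ιℤ c≡n*zCoeff)) (ιℤ-* (+ n) (zCoeff n i k)))) ⟩
      ((ν * ιℤ (zCoeff n i k)) * p 1 ^ k) * p (i ∸ k)
        ≈⟨ solve 4 (λ v a q r → ((v :* a) :* q) :* r := v :* ((a :* r) :* q)) refl _ _ _ _ ⟩
      ν * Z k ∎
      where
      i∸k≡ : i ∸ k ≡ suc (i ∸ k ∸ 1)
      i∸k≡ = ≡.sym (ℕ.m+[n∸m]≡n (ℕ.m<n⇒0<n∸m (s≤s (ℕ.m≤n⇒m≤1+n k≤m))))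
      c≡n*zCoeff : c k ≡ + n ℤ.* zCoeff n i k
      c≡n*zCoeff = ≡.trans
        (≡.cong (λ e → -1ℤ ℤ.^ k ℤ.* e ℤ.* + (i C k))
          (≡.trans (≡.cong (λ e → + (n ℕ.^ e)) i∸k≡) (ℤ.pos-* n (n ℕ.^ (i ∸ k ∸ 1)))))
        (rearrange (-1ℤ ℤ.^ k) (+ n) (+ (n ℕ.^ (i ∸ k ∸ 1))) (+ (i C k)))
        where
        rearrange : ∀ s u v w → s ℤ.* (u ℤ.* v) ℤ.* w ≡ u ℤ.* (s ℤ.* v ℤ.* w)
        rearrange = ℤ-solve-∀

    -- For k = i - 1 the remaining power sum is p₁, and for k = i it is p₀ = n. Both terms are
    -- therefore multiples of p₁^i, and their coefficients n i (-1)^(i-1) and n (-1)^i add up to n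
    -- (i-1) (-1)^(i+1).
    last-two : S (suc m) + S i ≈ ν * zₗ
    last-two = begin
      (ιℤ (c (suc m)) * p 1 ^ suc m) * p (i ∸ suc m) + (ιℤ (c i) * p 1 ^ i) * p (i ∸ i)
        ≈⟨ +-cong
             (trans (*-congˡ (reflexive (≡.cong p 1≡))) (trans (*-assoc _ _ _) (*-congˡ (*-comm _ _))))
             (trans (*-congˡ (trans (reflexive (≡.cong p (ℕ.n∸n≡0 i))) (powerSum-0 x)))
                    (solve 3 (λ a q v → (a :* q) :* v := (a :* v) :* q) refl _ _ _)) ⟩
      ιℤ (c (suc m)) * p 1 ^ i + (ιℤ (c i) * ν) * p 1 ^ i  ≈⟨ distribʳ _ _ _ ⟨
      (ιℤ (c (suc m)) + ιℤ (c i) * ν) * p 1 ^ i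
        ≈⟨ *-congʳ (trans (ιℤ-+ (c (suc m)) (c i ℤ.* + n)) (+-congˡ (ιℤ-* (c i) (+ n)))) ⟨
      ιℤ (c (suc m) ℤ.+ c i ℤ.* + n) * p 1 ^ i
        ≈⟨ *-congʳ (reflexive (≡.cong ιℤ coefficients)) ⟩
      ιℤ (+ n ℤ.* (+ suc m ℤ.* -1ℤ ℤ.^ (i ℕ.+ 1))) * p 1 ^ i
        ≈⟨ trans (*-congʳ (ιℤ-* (+ n) _)) (*-assoc _ _ _) ⟩
      ν * zₗ ∎
      where
      1≡ : i ∸ suc m ≡ 1
      1≡ = ℕ.m+n∸n≡m 1 (suc m)
      s = -1ℤ ℤ.^ suc m
      coefficients : c (suc m) ℤ.+ c i ℤ.* + n ≡ + n ℤ.* (+ suc m ℤ.* -1ℤ ℤ.^ (i ℕ.+ 1))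
      coefficients = ≡.trans
        (≡.cong₂ (λ a b → a ℤ.+ b ℤ.* + n)
          (≡.cong₂ (λ a b → s ℤ.* + a ℤ.* + b)
            (≡.trans (≡.cong (n ℕ.^_) 1≡) (ℕ.*-identityʳ n))
            (≡.trans (nCk≡nC[n∸k] (ℕ.n≤1+n (suc m))) (≡.trans (≡.cong (i C_) 1≡) (nC1≡n i))))
          (≡.cong₂ (λ a b → -1ℤ ℤ.* s ℤ.* + a ℤ.* + b) (≡.cong (n ℕ.^_) (ℕ.n∸n≡0 i)) (nCn≡1 i)))
        (≡.trans (rearrange s (+ n) (+ suc m))
          (≡.cong (λ e → + n ℤ.* (+ suc m ℤ.* -1ℤ ℤ.^ e)) (ℕ.+-comm 1 i)))
        where
        rearrange : ∀ s u v → s ℤ.* u ℤ.* (+ 1 ℤ.+ v) ℤ.+ (-1ℤ ℤ.* s ℤ.* + 1 ℤ.* + 1) ℤ.* u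
                            ≡ u ℤ.* (v ℤ.* (-1ℤ ℤ.* (-1ℤ ℤ.* s)))
        rearrange = ℤ-solve-∀

  module _ (x : Fin n → Carrier) {P : Pred Carrier 0ℓ} (sub : IsSubalgebra P) (0<n : 0 < n) where
    open IsSubalgebra sub

    powerSum∈ : P (powerSum x 1) → (∀ m → suc (suc m) ≤ n → P (zᴿ x (suc (suc m)))) → ∀ k → P (powerSum x k)
    powerSum∈ p₁∈ z∈ k = <-rec (P ∘ powerSum x) step k
      where
      step : ∀ k → (∀ {j} → j < k → P (powerSum x j)) → P (powerSum x k)
      step zero          rec = ≈-closed (sym (powerSum-0 x)) (ι-closed _)
      step (suc zero)    rec = p₁∈
      step i@(suc (suc m)) rec with i ℕ.≤? n
      ... | no  i≰n = powerSum-large∈ x sub i (ℕ.≰⇒> i≰n) (λ j → rec {j})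
      -- Subtracting from z_i its p₁^i term and the summands with k ≥ 1, all in P by induction,
      -- leaves the summand k = 0, which is n^(i-1) p_i.
      ... | yes i≤n = ιℤ*∈⁻ leading≢0 (≈-closed (*-identityʳ _) (+∈⁻
              (+∈⁻ (z∈ m i≤n) (*-closed (ι-closed _) (^∈ i p₁∈)))
              (∑∈ {n = m} λ κ →
                *-closed (*-closed (ι-closed _) (rec (s≤s (ℕ.m∸n≤m (suc m) (toℕ κ))))) (^∈ (suc (toℕ κ)) p₁∈))))
        where
        leading≢0 : zCoeff n i 0 ≢ + 0
        leading≢0 eq = ℕ.≢-nonZero⁻¹ (n ℕ.^ suc m) {{ℕ.m^n≢0 n (suc m) {{ℕ.>-nonZero 0<n}}}}
          (ℤ.+-injective (≡.trans (≡.sym leading≡) eq))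
          where
          leading≡ : zCoeff n i 0 ≡ + (n ℕ.^ suc m)
          leading≡ = ≡.trans
            (≡.cong (λ b → + 1 ℤ.* + (n ℕ.^ suc m) ℤ.* + b) (≡.trans (nCk≡nC[n∸k] {n = i} z≤n) (nCn≡1 i)))
            (≡.trans (ℤ.*-identityʳ _) (ℤ.*-identityˡ _))

  module _ {D : Carrier → Carrier} (der : IsDerivation D) (x : Fin n → Carrier)
           {e : ℤ} (Dx≈e : ∀ j → D (x j) ≈ ιℤ e) where
    open IsDerivation der

    D-powerSum-1 : D (powerSum x 1) ≈ ιℤ (+ n ℤ.* e)
    D-powerSum-1 = begin
      D (powerSum x 1)          ≈⟨ D-∑ (λ j → x j ^ 1) ⟩
      ∑ (λ j → D (x j ^ 1))     ≈⟨ sum-cong-≋ (λ j → trans (D-cong (*-identityʳ (x j))) (Dx≈e j)) ⟩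
      ∑ {n} (λ _ → ιℤ e)        ≈⟨ sum-replicate n ⟩
      n · ιℤ e                  ≈⟨ ·≈ιℤ* n (ιℤ e) ⟩
      ιℤ (+ n) * ιℤ e           ≈⟨ ιℤ-* (+ n) e ⟨
      ιℤ (+ n ℤ.* e)            ∎

    -- Both p₁ and n x_j have derivative n e.
    D-shifted : ∀ j → D (shifted x j) ≈ 0#
    D-shifted j = begin
      D (ιℤ -1ℤ * powerSum x 1 + ιℤ (+ n) * x j)        ≈⟨ D-+ _ _ ⟩
      D (ιℤ -1ℤ * powerSum x 1) + D (ιℤ (+ n) * x j)    ≈⟨ +-cong (D-ι* _ _) (D-ι* _ _) ⟩
      ιℤ -1ℤ * D (powerSum x 1) + ιℤ (+ n) * D (x j)
        ≈⟨ +-cong (*-congˡ (trans D-powerSum-1 (ιℤ-* (+ n) e))) (*-congˡ (Dx≈e j)) ⟩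
      ιℤ -1ℤ * (ιℤ (+ n) * ιℤ e) + ιℤ (+ n) * ιℤ e      ≈⟨ -1*x+x≈0 _ ⟩
      0# ∎

    D-z : ∀ m → 0 < n → D (zᴿ x (suc (suc m))) ≈ 0#
    D-z m 0<n = IsSubalgebra.ιℤ*∈⁻ kernel (λ n≡0 → ℕ.<⇒≢ 0<n (≡.sym (ℤ.+-injective n≡0)))
      (IsSubalgebra.≈-closed kernel (sym (n*z x m))
        (IsSubalgebra.∑∈ kernel λ j → IsSubalgebra.^∈ kernel (suc (suc m)) (D-shifted j)))

open import Data.Vec.Base using ([]; _∷_; zipWith; replicate; lookup; tabulate; _[_]%=_; _[_]≔_)
open import Data.Vec.Properties using
  (≡-dec; zipWith-assoc; zipWith-comm; zipWith-identityˡ; zipWith-replicate; lookup-zipWith; lookup-replicate;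
   lookup∘tabulate; tabulate∘lookup; tabulate-cong;
   lookup∘updateAt; lookup∘updateAt′; lookup∘update; lookup∘update′)
open ≡ hiding ([_])
open import Defs

-- The polynomial ring

infix 4 _≟ᵐ_
_≟ᵐ_ : DecidableEquality (Monomial n)
_≟ᵐ_ = ≡-dec ℕ._≟_

infixl 7 _∙_
_∙_ : Monomial n → Monomial n → Monomial n
_∙_ = zipWith ℕ._+_

𝟎 : Monomial n
𝟎 = replicate _ 0

-- Every linear functional on polynomials is of this form, and the operations
-- of Defs are transposes of operations on φ.
⟪_,_⟫ : Poly n → (Monomial n → ℚ) → ℚ
⟪ []          , φ ⟫ = 0ℚ
⟪ (c , a) ∷ f , φ ⟫ = c ℚ.* φ a ℚ.+ ⟪ f , φ ⟫

δ : Monomial n → Monomial n → ℚ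
δ m a = if does (a ≟ᵐ m) then 1ℚ else 0ℚ

δ-refl : (m : Monomial n) → δ m m ≡ 1ℚ
δ-refl m rewrite dec-true (m ≟ᵐ m) refl = refl

δ-≢ : {m a : Monomial n} → a ≢ m → δ m a ≡ 0ℚ
δ-≢ {m = m} {a} a≢m rewrite dec-false (a ≟ᵐ m) a≢m = refl

coeff≡⟪,δ⟫ : (f : Poly n) (m : Monomial n) → coeff f m ≡ ⟪ f , δ m ⟫
coeff≡⟪,δ⟫ []            m = refl
coeff≡⟪,δ⟫ ((c , a) ∷ f) m with a ≟ᵐ m
... | yes _ = cong₂ ℚ._+_ (sym (ℚ.*-identityʳ c)) (coeff≡⟪,δ⟫ f m)
... | no  _ = cong₂ ℚ._+_ (sym (ℚ.*-zeroʳ c)) (coeff≡⟪,δ⟫ f m)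

⟪⟫-congʳ : (f : Poly n) {φ ψ : Monomial n → ℚ} → φ ≗ ψ → ⟪ f , φ ⟫ ≡ ⟪ f , ψ ⟫
⟪⟫-congʳ []            φ≗ψ = refl
⟪⟫-congʳ ((c , a) ∷ f) φ≗ψ = cong₂ ℚ._+_ (cong (c ℚ.*_) (φ≗ψ a)) (⟪⟫-congʳ f φ≗ψ)

⟪⟫-++ : (f g : Poly n) (φ : Monomial n → ℚ) → ⟪ f ++ g , φ ⟫ ≡ ⟪ f , φ ⟫ ℚ.+ ⟪ g , φ ⟫
⟪⟫-++ []            g φ = sym (ℚ.+-identityˡ _)
⟪⟫-++ ((c , a) ∷ f) g φ =
  trans (cong (c ℚ.* φ a ℚ.+_) (⟪⟫-++ f g φ)) (sym (ℚ.+-assoc (c ℚ.* φ a) _ _))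

⟪⟫-+ : (f : Poly n) (φ ψ : Monomial n → ℚ) →
       ⟪ f , (λ a → φ a ℚ.+ ψ a) ⟫ ≡ ⟪ f , φ ⟫ ℚ.+ ⟪ f , ψ ⟫
⟪⟫-+ []            φ ψ = refl
⟪⟫-+ ((c , a) ∷ f) φ ψ = trans (cong (c ℚ.* (φ a ℚ.+ ψ a) ℚ.+_) (⟪⟫-+ f φ ψ))
  (solve 5 (λ c x y u v → c :* (x :+ y) :+ (u :+ v) := (c :* x :+ u) :+ (c :* y :+ v))
         refl c (φ a) (ψ a) ⟪ f , φ ⟫ ⟪ f , ψ ⟫)
  where open +-*-Solver

⟪⟫-* : (f : Poly n) (q : ℚ) (φ : Monomial n → ℚ) → ⟪ f , (λ a → q ℚ.* φ a) ⟫ ≡ q ℚ.* ⟪ f , φ ⟫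
⟪⟫-* []            q φ = sym (ℚ.*-zeroʳ q)
⟪⟫-* ((c , a) ∷ f) q φ = trans (cong (c ℚ.* (q ℚ.* φ a) ℚ.+_) (⟪⟫-* f q φ))
  (solve 4 (λ c q x u → c :* (q :* x) :+ q :* u := q :* (c :* x :+ u)) refl c q (φ a) ⟪ f , φ ⟫)
  where open +-*-Solver

⟪⟫-0 : (f : Poly n) → ⟪ f , (λ _ → 0ℚ) ⟫ ≡ 0ℚ
⟪⟫-0 f = trans (⟪⟫-* f 0ℚ (λ _ → 0ℚ)) (ℚ.*-zeroˡ ⟪ f , (λ _ → 0ℚ) ⟫)

-- Fubini for finite sums; commutativity of the product comes from it.
⟪⟫-swap : (f g : Poly n) (φ : Monomial n → Monomial n → ℚ) →
          ⟪ f , (λ a → ⟪ g , φ a ⟫) ⟫ ≡ ⟪ g , (λ b → ⟪ f , (λ a → φ a b) ⟫) ⟫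
⟪⟫-swap []            g φ = sym (⟪⟫-0 g)
⟪⟫-swap ((c , a) ∷ f) g φ = sym (trans (⟪⟫-+ g (λ b → c ℚ.* φ a b) (λ b → ⟪ f , (λ a → φ a b) ⟫))
  (cong₂ ℚ._+_ (⟪⟫-* g c (φ a)) (sym (⟪⟫-swap f g φ))))

⟪⟫-neg : (f : Poly n) (φ : Monomial n → ℚ) → ⟪ map (λ (c , a) → ℚ.- c , a) f , φ ⟫ ≡ ℚ.- ⟪ f , φ ⟫
⟪⟫-neg []            φ = refl
⟪⟫-neg ((c , a) ∷ f) φ = trans (cong (ℚ.- c ℚ.* φ a ℚ.+_) (⟪⟫-neg f φ))
  (solve 3 (λ c x u → :- c :* x :+ :- u := :- (c :* x :+ u)) refl c (φ a) ⟪ f , φ ⟫)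
  where open +-*-Solver

drop-monomial : Monomial n → Poly n → Poly n
drop-monomial m = filter (λ (_ , a) → ¬? (a ≟ᵐ m))

⟪⟫-drop : (m : Monomial n) (f : Poly n) (φ : Monomial n → ℚ) →
          ⟪ f , φ ⟫ ≡ coeff f m ℚ.* φ m ℚ.+ ⟪ drop-monomial m f , φ ⟫
⟪⟫-drop m []            φ = sym (trans (ℚ.+-identityʳ _) (ℚ.*-zeroˡ (φ m)))
⟪⟫-drop m ((c , a) ∷ f) φ with a ≟ᵐ m
... | yes refl = trans (cong (c ℚ.* φ m ℚ.+_) (⟪⟫-drop m f φ))
      (solve 4 (λ c x k u → c :* x :+ (k :* x :+ u) := (c :+ k) :* x :+ u)
             refl c (φ m) (coeff f m) ⟪ drop-monomial m f , φ ⟫)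
  where open +-*-Solver
... | no  _    = trans (cong (c ℚ.* φ a ℚ.+_) (⟪⟫-drop m f φ))
      (solve 4 (λ y x k u → y :+ (k :* x :+ u) := (con 0ℚ :+ k) :* x :+ (y :+ u))
             refl (c ℚ.* φ a) (φ m) (coeff f m) ⟪ drop-monomial m f , φ ⟫)
  where open +-*-Solver

-- By strong induction on the number of terms, removing all terms with the
-- same monomial as the head at once.
⟪⟫-null : (f : Poly n) (φ : Monomial n → ℚ) →
          (∀ m → coeff f m ≡ 0ℚ ⊎ φ m ≡ 0ℚ) → ⟪ f , φ ⟫ ≡ 0ℚ
⟪⟫-null f φ = go (length f) f ℕ.≤-refl
  where
  drop-self : ∀ m f → coeff (drop-monomial m f) m ≡ 0ℚ
  drop-self m [] = refl
  drop-self m ((c , a) ∷ f) with a ≟ᵐ m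
  ... | yes _  = drop-self m f
  ... | no a≢m rewrite dec-false (a ≟ᵐ m) a≢m = trans (ℚ.+-identityˡ _) (drop-self m f)

  drop-other : ∀ {m k} f → k ≢ m → coeff (drop-monomial m f) k ≡ coeff f k
  drop-other []            k≢m = refl
  drop-other {m} {k} ((c , a) ∷ f) k≢m with a ≟ᵐ m
  ... | no _     = cong ((if does (a ≟ᵐ k) then c else 0ℚ) ℚ.+_) (drop-other f k≢m)
  ... | yes refl rewrite dec-false (a ≟ᵐ k) (k≢m ∘ sym) =
        trans (drop-other f k≢m) (sym (ℚ.+-identityˡ _))

  drop-length : ∀ c a f → length (drop-monomial a ((c , a) ∷ f)) ℕ.≤ length f
  drop-length c a f rewrite dec-true (a ≟ᵐ a) refl = length-filter (λ (_ , b) → ¬? (b ≟ᵐ a)) f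

  go : ∀ k f → length f ℕ.≤ k → (∀ m → coeff f m ≡ 0ℚ ⊎ φ m ≡ 0ℚ) → ⟪ f , φ ⟫ ≡ 0ℚ
  go k       []                _         h = refl
  go (suc k) f@((c , a) ∷ f′) (s≤s f′≤k) h = begin
    ⟪ f , φ ⟫                                          ≡⟨ ⟪⟫-drop a f φ ⟩
    coeff f a ℚ.* φ a ℚ.+ ⟪ drop-monomial a f , φ ⟫
      ≡⟨ cong₂ ℚ._+_ head≡0 (go k (drop-monomial a f) (ℕ.≤-trans (drop-length c a f′) f′≤k) h′) ⟩
    0ℚ                                                 ∎
    where
    open ≡-Reasoning
    head≡0 : coeff f a ℚ.* φ a ≡ 0ℚ
    head≡0 with h a
    ... | inj₁ e = trans (cong (ℚ._* φ a) e) (ℚ.*-zeroˡ (φ a))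
    ... | inj₂ e = trans (cong (coeff f a ℚ.*_) e) (ℚ.*-zeroʳ (coeff f a))
    h′ : ∀ m → coeff (drop-monomial a f) m ≡ 0ℚ ⊎ φ m ≡ 0ℚ
    h′ m with m ≟ᵐ a
    ... | yes refl = inj₁ (drop-self m f)
    ... | no m≢a with h m
    ...   | inj₁ e = inj₁ (trans (drop-other f m≢a) e)
    ...   | inj₂ e = inj₂ e

-- All coefficients of f - g vanish, so `⟪⟫-null` makes every functional vanish on it. Together with
-- `⟪⟫-ext` this turns `_≈_` into agreement under all functionals, and an operation respects `_≈_`
-- as soon as it has a transpose.
⟪⟫-congˡ : {f g : Poly n} → f ≈ g → (φ : Monomial n → ℚ) → ⟪ f , φ ⟫ ≡ ⟪ g , φ ⟫
⟪⟫-congˡ {f = f} {g} f≈g φ = begin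
  ⟪ f , φ ⟫                                  ≡⟨ ℚ.+-identityʳ _ ⟨
  ⟪ f , φ ⟫ ℚ.+ 0ℚ                           ≡⟨ cong (⟪ f , φ ⟫ ℚ.+_) (ℚ.+-inverseˡ ⟪ g , φ ⟫) ⟨
  ⟪ f , φ ⟫ ℚ.+ (ℚ.- ⟪ g , φ ⟫ ℚ.+ ⟪ g , φ ⟫) ≡⟨ ℚ.+-assoc ⟪ f , φ ⟫ _ _ ⟨
  (⟪ f , φ ⟫ ℚ.+ ℚ.- ⟪ g , φ ⟫) ℚ.+ ⟪ g , φ ⟫ ≡⟨ cong (ℚ._+ ⟪ g , φ ⟫) (diff φ) ⟨
  ⟪ f-g , φ ⟫ ℚ.+ ⟪ g , φ ⟫                  ≡⟨ cong (ℚ._+ ⟪ g , φ ⟫) (⟪⟫-null f-g φ (inj₁ ∘ null)) ⟩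
  0ℚ ℚ.+ ⟪ g , φ ⟫                           ≡⟨ ℚ.+-identityˡ _ ⟩
  ⟪ g , φ ⟫                                  ∎
  where
  open ≡-Reasoning
  f-g = f ++ map (λ (c , a) → ℚ.- c , a) g
  diff : ∀ φ → ⟪ f-g , φ ⟫ ≡ ⟪ f , φ ⟫ ℚ.- ⟪ g , φ ⟫
  diff φ = trans (⟪⟫-++ f _ φ) (cong (⟪ f , φ ⟫ ℚ.+_) (⟪⟫-neg g φ))
  null : ∀ m → coeff f-g m ≡ 0ℚ
  null m = begin
    coeff f-g m                  ≡⟨ coeff≡⟪,δ⟫ f-g m ⟩
    ⟪ f-g , δ m ⟫                ≡⟨ diff (δ m) ⟩
    ⟪ f , δ m ⟫ ℚ.- ⟪ g , δ m ⟫  ≡⟨ cong₂ ℚ._-_ (coeff≡⟪,δ⟫ f m) (coeff≡⟪,δ⟫ g m) ⟨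
    coeff f m ℚ.- coeff g m      ≡⟨ cong (ℚ._- coeff g m) (coeff-≡ f≈g m) ⟩
    coeff g m ℚ.- coeff g m      ≡⟨ ℚ.+-inverseʳ (coeff g m) ⟩
    0ℚ                           ∎

⟪⟫-ext : {f g : Poly n} → (∀ φ → ⟪ f , φ ⟫ ≡ ⟪ g , φ ⟫) → f ≈ g
⟪⟫-ext {f = f} {g} h = mk≈ λ m →
  trans (coeff≡⟪,δ⟫ f m) (trans (h (δ m)) (sym (coeff≡⟪,δ⟫ g m)))

-- With products as iterated functionals, the ring laws reduce to linearity of the pairing,
-- `⟪⟫-swap` and the laws of addition of exponents.
⟪⟫-⊛ : (f g : Poly n) (φ : Monomial n → ℚ) →
       ⟪ cartesianProductWith mulTerm f g , φ ⟫ ≡ ⟪ f , (λ a → ⟪ g , (λ b → φ (zipWith ℕ._+_ a b)) ⟫) ⟫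
⟪⟫-⊛ []      g φ = refl
⟪⟫-⊛ (t@(c , a) ∷ f) g φ =
  trans (⟪⟫-++ (map (mulTerm t) g) _ φ) (cong₂ ℚ._+_ (term g) (⟪⟫-⊛ f g φ))
  where
  term : ∀ g → ⟪ map (mulTerm t) g , φ ⟫ ≡ c ℚ.* ⟪ g , (λ b → φ (zipWith ℕ._+_ a b)) ⟫
  term []            = sym (ℚ.*-zeroʳ c)
  term ((d , b) ∷ g) = trans (cong (c ℚ.* d ℚ.* φ (zipWith ℕ._+_ a b) ℚ.+_) (term g))
    (solve 4 (λ c d x u → c :* d :* x :+ c :* u := c :* (d :* x :+ u)) refl c d
      (φ (zipWith ℕ._+_ a b)) ⟪ g , (λ b → φ (zipWith ℕ._+_ a b)) ⟫)
    where open +-*-Solver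

⟪⟫-const : ∀ c (φ : Monomial n → ℚ) → ⟪ const c , φ ⟫ ≡ c ℚ.* φ (replicate n 0)
⟪⟫-const c φ = ℚ.+-identityʳ _

polyIsCommutativeRing : ∀ n → let open RawRing (polyRawRing n) using (_+_; _*_; -_; 0#; 1#) in
                        IsCommutativeRing (_≈_ {n}) _+_ _*_ -_ 0# 1#
polyIsCommutativeRing n = record
  { isRing = record
    { +-isAbelianGroup = record
      { isGroup = record
        { isMonoid = record
          { isSemigroup = record
            { isMagma = record
              { isEquivalence = record
                { refl  = mk≈ λ _ → refl
                ; sym   = λ p → mk≈ λ m → sym (coeff-≡ p m)
                ; trans = λ p q → mk≈ λ m → trans (coeff-≡ p m) (coeff-≡ q m)
                }
              ; ∙-cong = λ {f} {g} {h} {k} p q → ⟪⟫-ext λ φ →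
                  trans (⟪⟫-++ f h φ)
                    (trans (cong₂ ℚ._+_ (⟪⟫-congˡ p φ) (⟪⟫-congˡ q φ)) (sym (⟪⟫-++ g k φ)))
              }
            ; assoc = λ f g h → ⟪⟫-ext λ φ → trans (⟪⟫-++ (f ++ g) h φ)
                (trans (cong (ℚ._+ ⟪ h , φ ⟫) (⟪⟫-++ f g φ)) (trans (ℚ.+-assoc ⟪ f , φ ⟫ _ _)
                (sym (trans (⟪⟫-++ f (g ++ h) φ) (cong (⟪ f , φ ⟫ ℚ.+_) (⟪⟫-++ g h φ))))))
            }
          ; identity = (λ f → ⟪⟫-ext λ φ → refl)
                     , (λ f → ⟪⟫-ext λ φ → trans (⟪⟫-++ f [] φ) (ℚ.+-identityʳ _))
          }
        ; inverse = (λ f → ⟪⟫-ext λ φ → trans (⟪⟫-++ (neg f) f φ)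
                      (trans (cong (ℚ._+ ⟪ f , φ ⟫) (⟪⟫-neg f φ)) (ℚ.+-inverseˡ ⟪ f , φ ⟫)))
                  , (λ f → ⟪⟫-ext λ φ → trans (⟪⟫-++ f (neg f) φ)
                      (trans (cong (⟪ f , φ ⟫ ℚ.+_) (⟪⟫-neg f φ)) (ℚ.+-inverseʳ ⟪ f , φ ⟫)))
        ; ⁻¹-cong = λ {f} {g} p → ⟪⟫-ext λ φ →
            trans (⟪⟫-neg f φ) (trans (cong ℚ.-_ (⟪⟫-congˡ p φ)) (sym (⟪⟫-neg g φ)))
        }
      ; comm = λ f g → ⟪⟫-ext λ φ →
          trans (⟪⟫-++ f g φ) (trans (ℚ.+-comm ⟪ f , φ ⟫ _) (sym (⟪⟫-++ g f φ)))
      }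
    ; *-cong = λ {f} {g} {h} {k} p q → ⟪⟫-ext λ φ → trans (⟪⟫-⊛ f h φ)
        (trans (⟪⟫-congʳ f (λ a → ⟪⟫-congˡ q _)) (trans (⟪⟫-congˡ p _) (sym (⟪⟫-⊛ g k φ))))
    ; *-assoc = λ f g h → ⟪⟫-ext λ φ → begin
        ⟪ (f * g) * h , φ ⟫
          ≡⟨ trans (⟪⟫-⊛ (f * g) h φ) (⟪⟫-⊛ f g _) ⟩
        ⟪ f , (λ a → ⟪ g , (λ b → ⟪ h , (λ c → φ ((a ∙ b) ∙ c)) ⟫) ⟫) ⟫
          ≡⟨ ⟪⟫-congʳ f (λ a → ⟪⟫-congʳ g λ b → ⟪⟫-congʳ h λ c →
               cong φ (zipWith-assoc ℕ.+-assoc a b c)) ⟩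
        ⟪ f , (λ a → ⟪ g , (λ b → ⟪ h , (λ c → φ (a ∙ (b ∙ c))) ⟫) ⟫) ⟫
          ≡⟨ trans (⟪⟫-⊛ f (g * h) φ) (⟪⟫-congʳ f λ a → ⟪⟫-⊛ g h (φ ∘ (a ∙_))) ⟨
        ⟪ f * (g * h) , φ ⟫ ∎
    ; *-identity = *-identityˡ , λ f → ⟪⟫-ext λ φ →
        trans (⟪⟫-⊛-comm f (const 1ℚ) φ) (⟪⟫-congˡ (*-identityˡ f) φ)
    ; distrib = (λ f g h → ⟪⟫-ext λ φ → begin
          ⟪ f * (g ++ h) , φ ⟫
            ≡⟨ trans (⟪⟫-⊛ f (g ++ h) φ) (⟪⟫-congʳ f λ a → ⟪⟫-++ g h _) ⟩
          ⟪ f , (λ a → ⟪ g , φ ∘ (a ∙_) ⟫ ℚ.+ ⟪ h , φ ∘ (a ∙_) ⟫) ⟫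
            ≡⟨ ⟪⟫-+ f _ _ ⟩
          ⟪ f , (λ a → ⟪ g , φ ∘ (a ∙_) ⟫) ⟫ ℚ.+ ⟪ f , (λ a → ⟪ h , φ ∘ (a ∙_) ⟫) ⟫
            ≡⟨ trans (⟪⟫-++ (f * g) (f * h) φ) (cong₂ ℚ._+_ (⟪⟫-⊛ f g φ) (⟪⟫-⊛ f h φ)) ⟨
          ⟪ f * g ++ f * h , φ ⟫ ∎)
      , (λ f g h → ⟪⟫-ext λ φ → begin
          ⟪ (g ++ h) * f , φ ⟫
            ≡⟨ trans (⟪⟫-⊛ (g ++ h) f φ) (⟪⟫-++ g h _) ⟩
          ⟪ g , (λ a → ⟪ f , φ ∘ (a ∙_) ⟫) ⟫ ℚ.+ ⟪ h , (λ a → ⟪ f , φ ∘ (a ∙_) ⟫) ⟫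
            ≡⟨ trans (⟪⟫-++ (g * f) (h * f) φ) (cong₂ ℚ._+_ (⟪⟫-⊛ g f φ) (⟪⟫-⊛ h f φ)) ⟨
          ⟪ g * f ++ h * f , φ ⟫ ∎)
    }
  ; *-comm = λ f g → ⟪⟫-ext (⟪⟫-⊛-comm f g)
  }
  where
  open ≡-Reasoning
  open RawRing (polyRawRing n) using (_*_) renaming (-_ to neg)
  ⟪⟫-⊛-comm : ∀ f g φ → ⟪ f * g , φ ⟫ ≡ ⟪ g * f , φ ⟫
  ⟪⟫-⊛-comm f g φ = begin
    ⟪ f * g , φ ⟫                           ≡⟨ ⟪⟫-⊛ f g φ ⟩
    ⟪ f , (λ a → ⟪ g , (λ b → φ (a ∙ b)) ⟫) ⟫ ≡⟨ ⟪⟫-swap f g _ ⟩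
    ⟪ g , (λ b → ⟪ f , (λ a → φ (a ∙ b)) ⟫) ⟫
      ≡⟨ ⟪⟫-congʳ g (λ b → ⟪⟫-congʳ f λ a → cong φ (zipWith-comm ℕ.+-comm a b)) ⟩
    ⟪ g , (λ b → ⟪ f , (λ a → φ (b ∙ a)) ⟫) ⟫ ≡⟨ ⟪⟫-⊛ g f φ ⟨
    ⟪ g * f , φ ⟫                           ∎
  *-identityˡ : ∀ f → const 1ℚ * f ≈ f
  *-identityˡ f = ⟪⟫-ext λ φ → begin
    ⟪ const 1ℚ * f , φ ⟫                             ≡⟨ ⟪⟫-⊛ (const 1ℚ) f φ ⟩
    ⟪ const 1ℚ , (λ a → ⟪ f , φ ∘ (a ∙_) ⟫) ⟫        ≡⟨ ⟪⟫-const {n} 1ℚ (λ a → ⟪ f , φ ∘ (a ∙_) ⟫) ⟩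
    1ℚ ℚ.* ⟪ f , φ ∘ (replicate n 0 ∙_) ⟫           ≡⟨ ℚ.*-identityˡ _ ⟩
    ⟪ f , φ ∘ (replicate n 0 ∙_) ⟫
      ≡⟨ ⟪⟫-congʳ f (λ a → cong φ (zipWith-identityˡ ℕ.+-identityˡ a)) ⟩
    ⟪ f , φ ⟫                                        ∎

polyRing : ℕ → CommutativeRing 0ℓ 0ℓ
polyRing n = record { isCommutativeRing = polyIsCommutativeRing n }

lookup-ext : {a b : Monomial n} → (∀ i → lookup a i ≡ lookup b i) → a ≡ b
lookup-ext {a = a} {b} h = trans (sym (tabulate∘lookup a)) (trans (tabulate-cong h) (tabulate∘lookup b))

lookup-≔-≢ : ∀ {i j : Fin n} k → j ≢ i → lookup (𝟎 [ i ]≔ k) j ≡ 0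
lookup-≔-≢ {j = j} k j≢i = trans (lookup∘update′ j≢i 𝟎 k) (lookup-replicate j 0)

zero-or-positive : (a : Monomial n) → a ≡ 𝟎 ⊎ ∃ λ i → 0 < lookup a i
zero-or-positive []          = inj₁ refl
zero-or-positive (suc k ∷ a) = inj₂ (zero , s≤s z≤n)
zero-or-positive (zero  ∷ a) with zero-or-positive a
... | inj₁ refl      = inj₁ refl
... | inj₂ (i , 0<) = inj₂ (suc i , 0<)

const-isSemiringHomomorphism : ∀ n → SemiringMorphisms.IsSemiringHomomorphism
  ℚ.+-*-rawSemiring (Semiring.rawSemiring (CommutativeRing.semiring (polyRing n))) const
const-isSemiringHomomorphism n = record
  { isNearSemiringHomomorphism = record
    { +-isMonoidHomomorphism = record
      { isMagmaHomomorphism = record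
        { isRelHomomorphism = record { cong = λ { refl → R.refl } }
        ; homo = λ p q → ⟪⟫-ext λ φ → trans (⟪⟫-const {n} (p ℚ.+ q) φ)
            (trans (ℚ.*-distribʳ-+ (φ 𝟎) p q)
              (cong (p ℚ.* φ 𝟎 ℚ.+_) (sym (⟪⟫-const {n} q φ))))
        }
      ; ε-homo = ⟪⟫-ext λ φ → trans (⟪⟫-const {n} 0ℚ φ) (ℚ.*-zeroˡ (φ 𝟎))
      }
    ; *-homo = λ p q → ⟪⟫-ext λ φ → cong (λ a → p ℚ.* q ℚ.* φ a ℚ.+ 0ℚ) (sym (zipWith-replicate ℕ._+_ 0 0))
    }
  ; 1#-homo = R.refl
  }
  where module R = CommutativeRing (polyRing n)

module PolyAlgebra {n : ℕ} where
  open CommutativeRing (polyRing n) public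
    using (_+_; _*_; 0#; 1#; semiring; ring;
           +-cong; +-congˡ; +-congʳ; *-cong; *-congˡ; +-identityˡ;
           zeroʳ; -‿cong)
    renaming (refl to ≈-refl; sym to ≈-sym; trans to ≈-trans; reflexive to ≈-reflexive)
  open ℚ-Algebra (polyRing n) const (const-isSemiringHomomorphism n) public
  open AugmentedMonomials (polyRing n) public
  open import Algebra.Properties.Semiring.Sum semiring public
    using (sum; sum-cong-≋; ∑-distrib-+; *-distribˡ-sum; *-distribʳ-sum; sum-remove; sum-permute)
  open import Algebra.Properties.Semiring.Exp semiring public using (_^_; ^-congˡ)

open PolyAlgebra

⟪var^⟫ : (i : Fin n) (k : ℕ) (φ : Monomial n → ℚ) → ⟪ var i ^ k , φ ⟫ ≡ φ (𝟎 [ i ]≔ k)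
⟪var^⟫ {n} i zero φ = trans (⟪⟫-const {n} 1ℚ φ) (trans (ℚ.*-identityˡ _) (cong φ (lookup-ext zeros)))
  where
  zeros : ∀ j → lookup 𝟎 j ≡ lookup (𝟎 [ i ]≔ 0) j
  zeros j with j ≟ᶠ i
  ... | yes refl = trans (lookup-replicate j 0) (sym (lookup∘update j 𝟎 0))
  ... | no  j≢i  = trans (lookup-replicate j 0) (sym (lookup-≔-≢ 0 j≢i))
⟪var^⟫ {n} i (suc k) φ = begin
  ⟪ var i * var i ^ k , φ ⟫                    ≡⟨ ⟪⟫-⊛ (var i) (var i ^ k) φ ⟩
  1ℚ ℚ.* ⟪ var i ^ k , φ ∘ (eᵢ ∙_) ⟫ ℚ.+ 0ℚ  ≡⟨ trans (ℚ.+-identityʳ _) (ℚ.*-identityˡ _) ⟩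
  ⟪ var i ^ k , φ ∘ (eᵢ ∙_) ⟫                  ≡⟨ ⟪var^⟫ i k (φ ∘ (eᵢ ∙_)) ⟩
  φ (eᵢ ∙ (𝟎 [ i ]≔ k))                        ≡⟨ cong φ (lookup-ext exponents) ⟩
  φ (𝟎 [ i ]≔ suc k)                           ∎
  where
  open ≡-Reasoning
  eᵢ = 𝟎 [ i ]≔ 1
  exponents : ∀ j → lookup (eᵢ ∙ (𝟎 [ i ]≔ k)) j ≡ lookup (𝟎 [ i ]≔ suc k) j
  exponents j with j ≟ᶠ i
  ... | yes refl = trans (lookup-zipWith ℕ._+_ j eᵢ (𝟎 [ j ]≔ k))
        (trans (cong₂ ℕ._+_ (lookup∘update j 𝟎 1) (lookup∘update j 𝟎 k)) (sym (lookup∘update j 𝟎 (suc k))))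
  ... | no  j≢i  = trans (lookup-zipWith ℕ._+_ j eᵢ (𝟎 [ i ]≔ k))
        (trans (cong₂ ℕ._+_ (lookup-≔-≢ 1 j≢i) (lookup-≔-≢ k j≢i)) (sym (lookup-≔-≢ (suc k) j≢i)))

-- The exponent vector of x_{g 0}^{a 0} x_{g 1}^{a 1} ⋯.
exponents : ∀ {m} → (Fin m → Fin n) → (Fin m → ℕ) → Monomial n
exponents {m = zero}  g a = 𝟎
exponents {m = suc m} g a = (𝟎 [ g zero ]≔ a zero) ∙ exponents (g ∘ suc) (a ∘ suc)

-- The map g generalises the identity for the sake of the induction, which passes to `g ∘ suc`.
⟪mono⟫ : ∀ {m} (g : Fin m → Fin n) (a : Fin m → ℕ) (φ : Monomial n → ℚ) →
         ⟪ mono (var ∘ g) a , φ ⟫ ≡ φ (exponents g a)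
⟪mono⟫ {n} {zero}  g a φ = trans (⟪⟫-const {n} 1ℚ φ) (ℚ.*-identityˡ _)
⟪mono⟫ {n} {suc m} g a φ = begin
  ⟪ var (g zero) ^ a zero * mono (var ∘ g ∘ suc) (a ∘ suc) , φ ⟫
    ≡⟨ ⟪⟫-⊛ (var (g zero) ^ a zero) _ φ ⟩
  ⟪ var (g zero) ^ a zero , (λ b → ⟪ mono (var ∘ g ∘ suc) (a ∘ suc) , φ ∘ (b ∙_) ⟫) ⟫
    ≡⟨ ⟪var^⟫ (g zero) (a zero) _ ⟩
  ⟪ mono (var ∘ g ∘ suc) (a ∘ suc) , φ ∘ ((𝟎 [ g zero ]≔ a zero) ∙_) ⟫
    ≡⟨ ⟪mono⟫ (g ∘ suc) (a ∘ suc) _ ⟩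
  φ (exponents g a) ∎
  where open ≡-Reasoning

lookup-exponents-∉ : ∀ {m} (g : Fin m → Fin n) a {j} → (∀ i → j ≢ g i) → lookup (exponents g a) j ≡ 0
lookup-exponents-∉ {m = zero}  g a {j} j∉g = lookup-replicate j 0
lookup-exponents-∉ {m = suc m} g a {j} j∉g = trans (lookup-zipWith ℕ._+_ j (𝟎 [ g zero ]≔ a zero) _)
  (cong₂ ℕ._+_ (lookup-≔-≢ (a zero) (j∉g zero)) (lookup-exponents-∉ (g ∘ suc) (a ∘ suc) (j∉g ∘ suc)))

lookup-exponents : ∀ {m} (g : Fin m → Fin n) a → (∀ {i j} → g i ≡ g j → i ≡ j) →
                   ∀ i → lookup (exponents g a) (g i) ≡ a i
lookup-exponents g a g-inj zero = trans (lookup-zipWith ℕ._+_ (g zero) (𝟎 [ g zero ]≔ a zero) _)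
  (trans (cong₂ ℕ._+_ (lookup∘update (g zero) 𝟎 (a zero))
    (lookup-exponents-∉ (g ∘ suc) (a ∘ suc) λ i eq → contradiction (g-inj eq) λ ())) (ℕ.+-identityʳ (a zero)))
lookup-exponents g a g-inj (suc i) = trans (lookup-zipWith ℕ._+_ (g (suc i)) (𝟎 [ g zero ]≔ a zero) _)
  (cong₂ ℕ._+_ (lookup-≔-≢ (a zero) λ eq → contradiction (g-inj eq) λ ())
    (lookup-exponents (g ∘ suc) (a ∘ suc) (suc-injective ∘ g-inj) i))

-- The bridge from terms of a list to products of variables in the abstract algebra, where
-- `Σperm-mono` applies.
term≈ : (c : ℚ) (a : Monomial n) → [ c , a ] ≈ const c * mono var (lookup a)
term≈ {n} c a = ⟪⟫-ext λ φ → sym (begin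
  ⟪ const c * mono var (lookup a) , φ ⟫            ≡⟨ ⟪⟫-⊛ (const c) (mono var (lookup a)) φ ⟩
  ⟪ const c , (λ b → ⟪ mono var (lookup a) , φ ∘ (b ∙_) ⟫) ⟫
    ≡⟨ ⟪⟫-congʳ {n} (const c) (λ b → ⟪mono⟫ id (lookup a) (φ ∘ (b ∙_))) ⟩
  ⟪ const c , (λ b → φ (b ∙ exponents id (lookup a))) ⟫
    ≡⟨ cong (λ b → c ℚ.* φ b ℚ.+ 0ℚ) (lookup-ext λ i →
         trans (lookup-zipWith ℕ._+_ i 𝟎 (exponents id (lookup a)))
           (cong₂ ℕ._+_ (lookup-replicate i 0) (lookup-exponents id (lookup a) id i))) ⟩
  c ℚ.* φ a ℚ.+ 0ℚ ∎)
  where open ≡-Reasoning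

-- Symmetric polynomials

act : Permutation′ n → Monomial n → Monomial n
act σ a = tabulate λ j → lookup a (σ ⟨$⟩ˡ j)

⟪permute⟫ : (σ : Permutation′ n) (f : Poly n) (φ : Monomial n → ℚ) → ⟪ permute σ f , φ ⟫ ≡ ⟪ f , φ ∘ act σ ⟫
⟪permute⟫ σ []            φ = refl
⟪permute⟫ σ ((c , a) ∷ f) φ = cong (c ℚ.* φ (act σ a) ℚ.+_) (⟪permute⟫ σ f φ)

permute-cong : (σ : Permutation′ n) {f g : Poly n} → f ≈ g → permute σ f ≈ permute σ g
permute-cong σ {f} {g} f≈g = ⟪⟫-ext λ φ →
  trans (⟪permute⟫ σ f φ) (trans (⟪⟫-congˡ f≈g (φ ∘ act σ)) (sym (⟪permute⟫ σ g φ)))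

permute-+ : (σ : Permutation′ n) (f g : Poly n) → permute σ (f + g) ≈ permute σ f + permute σ g
permute-+ σ f g = ≈-reflexive (map-++ _ f g)

permute-* : (σ : Permutation′ n) (f g : Poly n) → permute σ (f * g) ≈ permute σ f * permute σ g
permute-* σ f g = ⟪⟫-ext λ φ → begin
  ⟪ permute σ (f * g) , φ ⟫                               ≡⟨ ⟪permute⟫ σ (f * g) φ ⟩
  ⟪ f * g , φ ∘ act σ ⟫                                   ≡⟨ ⟪⟫-⊛ f g (φ ∘ act σ) ⟩
  ⟪ f , (λ a → ⟪ g , (λ b → φ (act σ (a ∙ b))) ⟫) ⟫
    ≡⟨ ⟪⟫-congʳ f (λ a → ⟪⟫-congʳ g λ b → cong φ (lookup-ext (act-∙ a b))) ⟩
  ⟪ f , (λ a → ⟪ g , (λ b → φ (act σ a ∙ act σ b)) ⟫) ⟫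
    ≡⟨ ⟪⟫-congʳ f (λ a → ⟪permute⟫ σ g (φ ∘ (act σ a ∙_))) ⟨
  ⟪ f , (λ a → ⟪ permute σ g , φ ∘ (act σ a ∙_) ⟫) ⟫      ≡⟨ ⟪permute⟫ σ f _ ⟨
  ⟪ permute σ f , (λ a → ⟪ permute σ g , φ ∘ (a ∙_) ⟫) ⟫  ≡⟨ ⟪⟫-⊛ (permute σ f) (permute σ g) φ ⟨
  ⟪ permute σ f * permute σ g , φ ⟫                       ∎
  where
  open ≡-Reasoning
  act-∙ : ∀ a b j → lookup (act σ (a ∙ b)) j ≡ lookup (act σ a ∙ act σ b) j
  act-∙ a b j = begin
    lookup (act σ (a ∙ b)) j                             ≡⟨ lookup∘tabulate _ j ⟩
    lookup (a ∙ b) (σ ⟨$⟩ˡ j)                            ≡⟨ lookup-zipWith ℕ._+_ (σ ⟨$⟩ˡ j) a b ⟩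
    lookup a (σ ⟨$⟩ˡ j) ℕ.+ lookup b (σ ⟨$⟩ˡ j)
      ≡⟨ cong₂ ℕ._+_ (lookup∘tabulate _ j) (lookup∘tabulate _ j) ⟨
    lookup (act σ a) j ℕ.+ lookup (act σ b) j            ≡⟨ lookup-zipWith ℕ._+_ j (act σ a) (act σ b) ⟨
    lookup (act σ a ∙ act σ b) j                         ∎

permute-const : (σ : Permutation′ n) (c : ℚ) → permute σ (const c) ≈ const c
permute-const {n} σ c = ≈-reflexive (cong (λ a → [ c , a ]) (lookup-ext λ j →
  trans (lookup∘tabulate _ j) (trans (lookup-replicate (σ ⟨$⟩ˡ j) 0) (sym (lookup-replicate j 0)))))

permute-var : (σ : Permutation′ n) (i : Fin n) → permute σ (var i) ≈ var (σ ⟨$⟩ʳ i)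
permute-var {n} σ i = ≈-reflexive (cong (λ a → [ 1ℚ , a ])
  (lookup-ext λ j → trans (lookup∘tabulate _ j) (exponent j)))
  where
  exponent : ∀ j → lookup (𝟎 [ i ]≔ 1) (σ ⟨$⟩ˡ j) ≡ lookup (𝟎 [ σ ⟨$⟩ʳ i ]≔ 1) j
  exponent j with j ≟ᶠ σ ⟨$⟩ʳ i
  ... | yes refl = trans (cong (lookup (𝟎 [ i ]≔ 1)) (inverseˡ σ))
        (trans (lookup∘update i 𝟎 1) (sym (lookup∘update (σ ⟨$⟩ʳ i) 𝟎 1)))
  ... | no  j≢σi = trans (lookup-≔-≢ 1 λ eq → j≢σi (trans (sym (inverseʳ σ)) (cong (σ ⟨$⟩ʳ_) eq)))
        (sym (lookup-≔-≢ 1 j≢σi))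

permute-^ : (σ : Permutation′ n) (f : Poly n) (k : ℕ) → permute σ (f ^ k) ≈ permute σ f ^ k
permute-^ σ f zero    = permute-const σ 1ℚ
permute-^ σ f (suc k) = ≈-trans (permute-* σ f (f ^ k)) (*-congˡ {x = permute σ f} (permute-^ σ f k))

permute-sum : ∀ (σ : Permutation′ n) {m} (t : Fin m → Poly n) → permute σ (sum t) ≈ sum (permute σ ∘ t)
permute-sum σ {zero}  t = ≈-refl
permute-sum σ {suc m} t = ≈-trans (permute-+ σ (t zero) (sum (t ∘ suc)))
  (+-congˡ {x = permute σ (t zero)} (permute-sum σ (t ∘ suc)))

Λ-isSubalgebra : IsSubalgebra (Λ n)
Λ-isSubalgebra = record
  { ι-closed = λ c σ → permute-const σ c
  ; +-closed = λ {f} {g} f∈ g∈ σ → ≈-trans (permute-+ σ f g) (+-cong (f∈ σ) (g∈ σ))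
  ; *-closed = λ {f} {g} f∈ g∈ σ → ≈-trans (permute-* σ f g) (*-cong (f∈ σ) (g∈ σ))
  ; ≈-closed = λ f≈g f∈ σ → ≈-trans (permute-cong σ (≈-sym f≈g)) (≈-trans (f∈ σ) f≈g)
  }

p∈Λ : ∀ k → Λ n (p n k)
p∈Λ {n} k σ = ≈-trans (permute-sum σ λ i → var i ^ k) (≈-trans
  (sum-cong-≋ λ i → ≈-trans (permute-^ σ (var i) k) (^-congˡ k (permute-var σ i)))
  (≈-sym (sum-permute (λ i → var i ^ k) σ)))

-- Symmetric polynomials are their own averages over all permutations, up to
-- the factor n!, and the average of a monomial is an augmented monomial.
Λ⊆ : {P : Pred (Poly n) 0ℓ} → IsSubalgebra P → (∀ k → P (p n k)) → ∀ {f} → Λ n f → P f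
Λ⊆ {n} {P} sub p∈ {f} f∈Λ = ιℤ*∈⁻ (λ eq → ℕ.≢-nonZero⁻¹ (n !) {{n !≢0}} (ℤ.+-injective eq)) (≈-closed (≈-trans
    (Σperm-cong n f∈Λ) (≈-trans (Σperm-const n f) (·≈ιℤ* (n !) f))) (average∈ f))
  where
  open IsSubalgebra sub
  -- This is shown for arbitrary f, as the induction on the list of terms passes through polynomials
  -- that need not be symmetric.
  average∈ : ∀ f → P (Σperm n λ π → permute π f)
  average∈ [] = ≈-closed (≈-sym (≈-trans (Σperm-const n 0#) (≈-trans (·≈ιℤ* (n !) 0#) (zeroʳ (ιℤ (+ (n !))))))) 0∈
  average∈ ((c , a) ∷ f) = ≈-closed (≈-sym (≈-trans (Σperm-+ n (λ π → [ c , act π a ]) (λ π → permute π f))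
      (+-congʳ {x = Σperm n λ π → permute π f} (≈-trans
        (Σperm-cong n λ π → ≈-trans (term≈ c (act π a))
          (*-congˡ {x = const c} (mono-cong var λ i → lookup∘tabulate (λ j → lookup a (π ⟨$⟩ˡ j)) i)))
        (≈-trans (Σperm-* n (const c) λ π → mono var λ i → lookup a (π ⟨$⟩ˡ i))
          (*-congˡ {x = const c} (Σperm-mono var (lookup a))))))))
    (+-closed (*-closed (ι-closed c) (aug∈ var sub _ _ refl λ k _ → p∈ k)) (average∈ f))

-- The operators D₋ and D₊

⟪∂⟫ : (i : Fin n) (f : Poly n) (φ : Monomial n → ℚ) →
      ⟪ ∂ i f , φ ⟫ ≡ ⟪ f , (λ a → fromℤ (+ lookup a i) ℚ.* φ (a [ i ]%= ℕ.pred)) ⟫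
⟪∂⟫ i []            φ = refl
⟪∂⟫ i ((c , a) ∷ f) φ = cong₂ ℚ._+_
  (trans (cong (ℚ._* φ (a [ i ]%= ℕ.pred)) (ℚ.*-comm (fromℤ (+ lookup a i)) c)) (ℚ.*-assoc c _ _)) (⟪∂⟫ i f φ)

∂-cong : (i : Fin n) {f g : Poly n} → f ≈ g → ∂ i f ≈ ∂ i g
∂-cong i {f} {g} f≈g = ⟪⟫-ext λ φ → trans (⟪∂⟫ i f φ) (trans (⟪⟫-congˡ f≈g _) (sym (⟪∂⟫ i g φ)))

∂-const : (i : Fin n) (c : ℚ) → ∂ i (const c) ≈ 0#
∂-const i c = ⟪⟫-ext λ φ → trans
  (cong (λ k → fromℤ (+ k) ℚ.* c ℚ.* φ (𝟎 [ i ]%= ℕ.pred) ℚ.+ 0ℚ) (lookup-replicate i 0))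
  (trans (ℚ.+-identityʳ _) (trans (cong (ℚ._* φ (𝟎 [ i ]%= ℕ.pred)) (ℚ.*-zeroˡ c))
    (ℚ.*-zeroˡ (φ (𝟎 [ i ]%= ℕ.pred)))))

∂-+ : (i : Fin n) (f g : Poly n) → ∂ i (f + g) ≈ ∂ i f + ∂ i g
∂-+ i f g = ≈-reflexive (map-++ _ f g)

-- Truncation of the predecessor does not matter where the exponent vanishes.
pred-∙ : (a b : Monomial n) (i : Fin n) (φ : Monomial n → ℚ) →
         fromℤ (+ lookup a i) ℚ.* φ ((a ∙ b) [ i ]%= ℕ.pred)
         ≡ fromℤ (+ lookup a i) ℚ.* φ ((a [ i ]%= ℕ.pred) ∙ b)
pred-∙ a b i φ with lookup a i in eq
... | zero  = trans (ℚ.*-zeroˡ (φ _)) (sym (ℚ.*-zeroˡ (φ _)))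
... | suc k = cong (λ m → fromℤ (+ suc k) ℚ.* φ m) (lookup-ext same)
  where
  open ≡-Reasoning
  same : ∀ j → lookup ((a ∙ b) [ i ]%= ℕ.pred) j ≡ lookup ((a [ i ]%= ℕ.pred) ∙ b) j
  same j with j ≟ᶠ i
  ... | yes refl = begin
    lookup ((a ∙ b) [ j ]%= ℕ.pred) j              ≡⟨ lookup∘updateAt j (a ∙ b) ⟩
    ℕ.pred (lookup (a ∙ b) j)                      ≡⟨ cong ℕ.pred (lookup-zipWith ℕ._+_ j a b) ⟩
    ℕ.pred (lookup a j ℕ.+ lookup b j)             ≡⟨ cong (λ m → ℕ.pred (m ℕ.+ lookup b j)) eq ⟩
    ℕ.pred (suc k) ℕ.+ lookup b j                  ≡⟨ cong (λ m → ℕ.pred m ℕ.+ lookup b j) eq ⟨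
    ℕ.pred (lookup a j) ℕ.+ lookup b j             ≡⟨ cong (ℕ._+ lookup b j) (lookup∘updateAt j a) ⟨
    lookup (a [ j ]%= ℕ.pred) j ℕ.+ lookup b j     ≡⟨ lookup-zipWith ℕ._+_ j (a [ j ]%= ℕ.pred) b ⟨
    lookup ((a [ j ]%= ℕ.pred) ∙ b) j              ∎
  ... | no  j≢i = begin
    lookup ((a ∙ b) [ i ]%= ℕ.pred) j              ≡⟨ lookup∘updateAt′ j i j≢i (a ∙ b) ⟩
    lookup (a ∙ b) j                               ≡⟨ lookup-zipWith ℕ._+_ j a b ⟩
    lookup a j ℕ.+ lookup b j                      ≡⟨ cong (ℕ._+ lookup b j) (lookup∘updateAt′ j i j≢i a) ⟨
    lookup (a [ i ]%= ℕ.pred) j ℕ.+ lookup b j     ≡⟨ lookup-zipWith ℕ._+_ j (a [ i ]%= ℕ.pred) b ⟨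
    lookup ((a [ i ]%= ℕ.pred) ∙ b) j              ∎

∙-comm : (a b : Monomial n) → a ∙ b ≡ b ∙ a
∙-comm = zipWith-comm ℕ.+-comm

∂-* : (i : Fin n) (f g : Poly n) → ∂ i (f * g) ≈ ∂ i f * g + f * ∂ i g
∂-* {n} i f g = ⟪⟫-ext λ φ → begin
  ⟪ ∂ i (f * g) , φ ⟫
    ≡⟨ trans (⟪∂⟫ i (f * g) φ) (⟪⟫-⊛ f g _) ⟩
  ⟪ f , (λ a → ⟪ g , (λ b → fromℤ (+ lookup (a ∙ b) i) ℚ.* φ ((a ∙ b) ⁻)) ⟫) ⟫
    ≡⟨ ⟪⟫-congʳ f (λ a → trans (⟪⟫-congʳ g λ b → leibniz φ a b) (⟪⟫-+ g _ _)) ⟩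
  ⟪ f , (λ a → ⟪ g , (λ b → e a ℚ.* φ (a ⁻ ∙ b)) ⟫ ℚ.+ ⟪ g , (λ b → e b ℚ.* φ (a ∙ b ⁻)) ⟫) ⟫
    ≡⟨ ⟪⟫-+ f _ _ ⟩
  ⟪ f , (λ a → ⟪ g , (λ b → e a ℚ.* φ (a ⁻ ∙ b)) ⟫) ⟫ ℚ.+ ⟪ f , (λ a → ⟪ g , (λ b → e b ℚ.* φ (a ∙ b ⁻)) ⟫) ⟫
    ≡⟨ cong₂ ℚ._+_ (⟪⟫-congʳ f λ a → ⟪⟫-* g (e a) (λ b → φ (a ⁻ ∙ b)))
                   (⟪⟫-congʳ f λ a → sym (⟪∂⟫ i g (φ ∘ (a ∙_)))) ⟩
  ⟪ f , (λ a → e a ℚ.* ⟪ g , φ ∘ (a ⁻ ∙_) ⟫) ⟫ ℚ.+ ⟪ f , (λ a → ⟪ ∂ i g , φ ∘ (a ∙_) ⟫) ⟫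
    ≡⟨ cong₂ ℚ._+_ (trans (⟪⟫-⊛ (∂ i f) g φ) (⟪∂⟫ i f _)) (⟪⟫-⊛ f (∂ i g) φ) ⟨
  ⟪ ∂ i f * g , φ ⟫ ℚ.+ ⟪ f * ∂ i g , φ ⟫
    ≡⟨ ⟪⟫-++ (∂ i f * g) (f * ∂ i g) φ ⟨
  ⟪ ∂ i f * g + f * ∂ i g , φ ⟫ ∎
  where
  open ≡-Reasoning
  infix 9 _⁻
  _⁻ : Monomial n → Monomial n
  a ⁻ = a [ i ]%= ℕ.pred
  e : Monomial n → ℚ
  e a = fromℤ (+ lookup a i)
  -- The Leibniz rule for two monomials: the exponent of x_i in the product is a sum, and each
  -- summand allows the lowering to be done in its own factor.
  leibniz : ∀ φ a b → e (a ∙ b) ℚ.* φ ((a ∙ b) ⁻) ≡ e a ℚ.* φ (a ⁻ ∙ b) ℚ.+ e b ℚ.* φ (a ∙ b ⁻)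
  leibniz φ a b = begin
    e (a ∙ b) ℚ.* φ ((a ∙ b) ⁻)
      ≡⟨ cong (ℚ._* φ ((a ∙ b) ⁻)) (trans (cong (λ k → fromℤ (+ k)) (lookup-zipWith ℕ._+_ i a b))
           (fromℤ-+ (+ lookup a i) (+ lookup b i))) ⟩
    (e a ℚ.+ e b) ℚ.* φ ((a ∙ b) ⁻)
      ≡⟨ ℚ.*-distribʳ-+ (φ ((a ∙ b) ⁻)) (e a) (e b) ⟩
    e a ℚ.* φ ((a ∙ b) ⁻) ℚ.+ e b ℚ.* φ ((a ∙ b) ⁻)
      ≡⟨ cong₂ ℚ._+_ (pred-∙ a b i φ) (begin
           e b ℚ.* φ ((a ∙ b) ⁻)  ≡⟨ cong (λ m → e b ℚ.* φ (m ⁻)) (∙-comm a b) ⟩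
           e b ℚ.* φ ((b ∙ a) ⁻)  ≡⟨ pred-∙ b a i φ ⟩
           e b ℚ.* φ (b ⁻ ∙ a)    ≡⟨ cong (λ m → e b ℚ.* φ m) (∙-comm (b ⁻) a) ⟩
           e b ℚ.* φ (a ∙ b ⁻)    ∎) ⟩
    e a ℚ.* φ (a ⁻ ∙ b) ℚ.+ e b ℚ.* φ (a ∙ b ⁻) ∎

∂-var : (i : Fin n) → ∂ i (var i) ≈ const 1ℚ
∂-var i = ≈-reflexive (cong₂ (λ k a → [ fromℤ (+ k) ℚ.* 1ℚ , a ]) (lookup∘update i 𝟎 1) (lookup-ext zeros))
  where
  zeros : ∀ j → lookup ((𝟎 [ i ]≔ 1) [ i ]%= ℕ.pred) j ≡ lookup 𝟎 j
  zeros j with j ≟ᶠ i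
  ... | yes refl = trans (lookup∘updateAt j (𝟎 [ j ]≔ 1))
        (trans (cong ℕ.pred (lookup∘update j 𝟎 1)) (sym (lookup-replicate j 0)))
  ... | no  j≢i  = trans (lookup∘updateAt′ j i j≢i (𝟎 [ i ]≔ 1)) (lookup∘update′ j≢i 𝟎 1)

∂-var-≢ : {i j : Fin n} → i ≢ j → ∂ i (var j) ≈ 0#
∂-var-≢ {i = i} {j} i≢j = ⟪⟫-ext λ φ → trans
  (cong (λ k → fromℤ (+ k) ℚ.* 1ℚ ℚ.* φ ((𝟎 [ j ]≔ 1) [ i ]%= ℕ.pred) ℚ.+ 0ℚ) (lookup-≔-≢ 1 i≢j))
  (trans (ℚ.+-identityʳ _) (ℚ.*-zeroˡ (φ ((𝟎 [ j ]≔ 1) [ i ]%= ℕ.pred))))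

⟪⟫-sum-single : (t : Fin n → Poly n) (i : Fin n) (φ : Monomial n → ℚ) →
                (∀ j → j ≢ i → ⟪ t j , φ ⟫ ≡ 0ℚ) → ⟪ sum t , φ ⟫ ≡ ⟪ t i , φ ⟫
⟪⟫-sum-single {suc n} t i φ t≡0 = trans (⟪⟫-congˡ (sum-remove {i = i} t) φ)
  (trans (⟪⟫-++ (t i) _ φ) (trans (cong (⟪ t i , φ ⟫ ℚ.+_)
    (vanish (t ∘ punchIn i) λ j → t≡0 (punchIn i j) (punchInᵢ≢i i j))) (ℚ.+-identityʳ _)))
  where
  vanish : ∀ {m} (t : Fin m → Poly (suc n)) → (∀ j → ⟪ t j , φ ⟫ ≡ 0ℚ) → ⟪ sum t , φ ⟫ ≡ 0ℚ
  vanish {zero}  t h = refl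
  vanish {suc m} t h = trans (⟪⟫-++ (t zero) (sum (t ∘ suc)) φ) (cong₂ ℚ._+_ (h zero) (vanish (t ∘ suc) (h ∘ suc)))

sum-0 : ∀ {m} {t : Fin m → Poly n} → (∀ j → t j ≈ 0#) → sum t ≈ 0#
sum-0 {m = zero}  h = ≈-refl
sum-0 {m = suc m} h = ≈-trans (+-cong (h zero) (sum-0 (h ∘ suc))) (+-identityˡ 0#)

D₋-isDerivation : IsDerivation (D₋ n)
D₋-isDerivation {n} = record
  { D-cong = λ f≈g → -‿cong (sum-cong-≋ λ i → ∂-cong i f≈g)
  ; D-+ = λ f g → ≈-trans
      (-‿cong (≈-trans (sum-cong-≋ λ i → ∂-+ i f g) (∑-distrib-+ (λ i → ∂ i f) (λ i → ∂ i g))))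
      (≈-sym (-‿+-comm (sum λ i → ∂ i f) (sum λ i → ∂ i g)))
  ; D-* = λ f g → ≈-trans (-‿cong (≈-trans (sum-cong-≋ λ i → ∂-* i f g)
        (≈-trans (∑-distrib-+ (λ i → ∂ i f * g) (λ i → f * ∂ i g))
          (+-cong (≈-sym (*-distribʳ-sum g λ i → ∂ i f)) (≈-sym (*-distribˡ-sum f λ i → ∂ i g))))))
      (≈-trans (≈-sym (-‿+-comm ((sum λ i → ∂ i f) * g) (f * (sum λ i → ∂ i g))))
        (+-cong (-‿distribˡ-* (sum λ i → ∂ i f) g) (-‿distribʳ-* f (sum λ i → ∂ i g))))
  ; D-ι = λ c → ≈-trans (-‿cong (sum-0 λ i → ∂-const i c)) -0#≈0#
  }
  where open Algebra.Properties.Ring (ring {n}) using (-‿distribˡ-*; -‿distribʳ-*; -‿+-comm; -0#≈0#)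

D₋-var : (j : Fin n) → D₋ n (var j) ≈ ιℤ -1ℤ
D₋-var {n} j = ≈-trans
  (-‿cong (⟪⟫-ext λ φ → ⟪⟫-sum-single (λ i → ∂ i (var j)) j φ λ i i≢j → ⟪⟫-congˡ (∂-var-≢ i≢j) φ))
  (-‿cong (∂-var j))

-- The kernel of D₊

⟪x²∂⟫ : (i : Fin n) (f : Poly n) (φ : Monomial n → ℚ) →
        ⟪ var i ^ 2 * ∂ i f , φ ⟫
        ≡ ⟪ f , (λ a → fromℤ (+ lookup a i) ℚ.* φ ((𝟎 [ i ]≔ 2) ∙ (a [ i ]%= ℕ.pred))) ⟫
⟪x²∂⟫ i f φ = trans (⟪⟫-⊛ (var i ^ 2) (∂ i f) φ)
  (trans (⟪var^⟫ i 2 λ a → ⟪ ∂ i f , φ ∘ (a ∙_) ⟫) (⟪∂⟫ i f (φ ∘ ((𝟎 [ i ]≔ 2) ∙_))))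

-- On a positive exponent the predecessor does not truncate, and 2 + (a_i - 1) = a_i + 1.
lookup-raise : (i : Fin n) (a : Monomial n) → 0 < lookup a i →
               lookup ((𝟎 [ i ]≔ 2) ∙ (a [ i ]%= ℕ.pred)) i ≡ suc (lookup a i)
lookup-raise i a 0<aᵢ = trans (lookup-zipWith ℕ._+_ i (𝟎 [ i ]≔ 2) (a [ i ]%= ℕ.pred))
  (trans (cong₂ ℕ._+_ (lookup∘update i 𝟎 2) (lookup∘updateAt i a))
    (cong suc (ℕ.suc-pred (lookup a i) {{ℕ.>-nonZero 0<aᵢ}})))

lookup-raise-≢ : {i j : Fin n} (a : Monomial n) → j ≢ i →
                 lookup ((𝟎 [ i ]≔ 2) ∙ (a [ i ]%= ℕ.pred)) j ≡ lookup a j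
lookup-raise-≢ {i = i} {j} a j≢i = trans (lookup-zipWith ℕ._+_ j (𝟎 [ i ]≔ 2) (a [ i ]%= ℕ.pred))
  (cong₂ ℕ._+_ (lookup-≔-≢ 2 j≢i) (lookup∘updateAt′ j i j≢i a))

-- In the coefficient of x_i·xᵃ in D₊ f only the terms from xᵃ survive if
-- f has no monomial of larger degree in x_i: the other x_j² ∂_j preserve that degree.
D₊-leading : {f : Poly n} (i : Fin n) (a : Monomial n) → D₊ n f ≈ 0# → 0 < lookup a i →
             (∀ b → lookup a i < lookup b i → coeff f b ≡ 0ℚ) → coeff f a ≡ 0ℚ
D₊-leading {n} {f} i a Df≈0 0<aᵢ above = ℚ-cancel (begin
  fromℤ (+ lookup a i) ℚ.* coeff f a            ≡⟨ cong (fromℤ (+ lookup a i) ℚ.*_) (coeff≡⟪,δ⟫ f a) ⟩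
  fromℤ (+ lookup a i) ℚ.* ⟪ f , δ a ⟫          ≡⟨ ⟪⟫-* f (fromℤ (+ lookup a i)) (δ a) ⟨
  ⟪ f , (λ b → fromℤ (+ lookup a i) ℚ.* δ a b) ⟫ ≡⟨ ⟪⟫-congʳ f main ⟨
  ⟪ f , (λ b → fromℤ (+ lookup b i) ℚ.* δ (raise i a) (raise i b)) ⟫
    ≡⟨ ⟪x²∂⟫ i f (δ (raise i a)) ⟨
  ⟪ var i ^ 2 * ∂ i f , δ (raise i a) ⟫
    ≡⟨ ⟪⟫-sum-single (λ j → var j ^ 2 * ∂ j f) i (δ (raise i a)) other ⟨
  ⟪ D₊ n f , δ (raise i a) ⟫                    ≡⟨ ⟪⟫-congˡ Df≈0 (δ (raise i a)) ⟩
  0ℚ                                            ∎)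
  where
  open ≡-Reasoning
  raise : Fin n → Monomial n → Monomial n
  raise j b = (𝟎 [ j ]≔ 2) ∙ (b [ j ]%= ℕ.pred)

  -- Multiplication by x_i is injective, so among the monomials containing x_i only xᵃ reaches
  -- x_i·xᵃ; those without x_i have weight 0.
  main : ∀ b → fromℤ (+ lookup b i) ℚ.* δ (raise i a) (raise i b) ≡ fromℤ (+ lookup a i) ℚ.* δ a b
  main b with b ≟ᵐ a
  ... | yes refl = cong (fromℤ (+ lookup b i) ℚ.*_) (δ-refl (raise i b))
  ... | no  b≢a with lookup b i in eq
  ...   | zero  = trans (ℚ.*-zeroˡ (δ (raise i a) (raise i b))) (sym (ℚ.*-zeroʳ (fromℤ (+ lookup a i))))
  ...   | suc k = trans (cong (fromℤ (+ suc k) ℚ.*_) (δ-≢ λ same → b≢a (lookup-ext λ j → equal same j)))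
                    (trans (ℚ.*-zeroʳ (fromℤ (+ suc k))) (sym (ℚ.*-zeroʳ (fromℤ (+ lookup a i)))))
    where
    equal : raise i b ≡ raise i a → ∀ j → lookup b j ≡ lookup a j
    equal same j with j ≟ᶠ i
    ... | yes refl = ℕ.suc-injective (trans (sym (lookup-raise j b (subst (0 <_) (sym eq) (s≤s z≤n))))
                       (trans (cong (λ m → lookup m j) same) (lookup-raise j a 0<aᵢ)))
    ... | no  j≢i  = trans (sym (lookup-raise-≢ b j≢i))
                       (trans (cong (λ m → lookup m j) same) (lookup-raise-≢ a j≢i))

  -- If x_j² ∂_j leads from xᵇ to x_i·xᵃ, then b has degree a_i + 1 in x_i, where f has no
  -- coefficients by `above`.
  other : ∀ j → j ≢ i → ⟪ var j ^ 2 * ∂ j f , δ (raise i a) ⟫ ≡ 0ℚ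
  other j j≢i = trans (⟪x²∂⟫ j f (δ (raise i a))) (⟪⟫-null f _ vanish)
    where
    vanish : ∀ b → coeff f b ≡ 0ℚ ⊎ fromℤ (+ lookup b j) ℚ.* δ (raise i a) (raise j b) ≡ 0ℚ
    vanish b with raise j b ≟ᵐ raise i a
    ... | no  ≢    = inj₂ (ℚ.*-zeroʳ (fromℤ (+ lookup b j)))
    ... | yes same = inj₁ (above b (ℕ.≤-reflexive (trans (sym (lookup-raise i a 0<aᵢ))
                       (trans (cong (λ m → lookup m i) (sym same)) (lookup-raise-≢ b (j≢i ∘ sym))))))

  ℚ-cancel : ∀ {q} → fromℤ (+ lookup a i) ℚ.* q ≡ 0ℚ → q ≡ 0ℚ
  ℚ-cancel {q} eq = trans (sym (ℚ.*-identityˡ q)) (trans (cong (ℚ._* q) (sym (ℚ.*-inverseˡ d)))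
    (trans (ℚ.*-assoc (ℚ.1/ d) d q) (trans (cong (ℚ.1/ d ℚ.*_) eq) (ℚ.*-zeroʳ (ℚ.1/ d)))))
    where
    d = fromℤ (+ lookup a i)
    instance _ = ℚ.≢-nonZero (fromℤ-≢0 λ eq → ℕ.<⇒≢ 0<aᵢ (sym (ℤ.+-injective eq)))

-- Terms with zero or cancelling coefficients count as well, so this is an upper bound for the
-- degree in x_i rather than the degree itself.
degree-bound : Fin n → Poly n → ℕ
degree-bound i []            = 0
degree-bound i ((c , a) ∷ f) = lookup a i ⊔ degree-bound i f

coeff-above : (i : Fin n) (f : Poly n) (m : Monomial n) → degree-bound i f < lookup m i → coeff f m ≡ 0ℚ
coeff-above i []            m _  = refl
coeff-above i ((c , a) ∷ f) m b< with a ≟ᵐ m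
... | yes refl = contradiction (ℕ.m≤m⊔n (lookup a i) _) (ℕ.<⇒≱ b<)
... | no  _    = trans (ℚ.+-identityˡ _) (coeff-above i f m (ℕ.≤-<-trans (ℕ.m≤n⊔m (lookup a i) _) b<))

D₊-kernel : {f : Poly n} → D₊ n f ≈ 0# → Constant f
D₊-kernel {n} {f} Df≈0 = coeff f 𝟎 , mk≈ agree
  where
  -- A downward induction on the degree in x_i takes the place of choosing a maximal monomial. The
  -- number k limits how far that degree may lie below the bound; at k = 0 it exceeds the degree of
  -- every term of f.
  descend : ∀ i k a → 0 < lookup a i → degree-bound i f < lookup a i ℕ.+ k → coeff f a ≡ 0ℚ
  descend i zero    a 0<aᵢ b< = coeff-above i f a (subst (degree-bound i f <_) (ℕ.+-identityʳ _) b<)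
  descend i (suc k) a 0<aᵢ b< = D₊-leading i a Df≈0 0<aᵢ λ b a<b → descend i k b (ℕ.<-trans 0<aᵢ a<b)
    (ℕ.<-≤-trans b< (ℕ.≤-trans (ℕ.≤-reflexive (ℕ.+-suc (lookup a i) k)) (ℕ.+-monoˡ-≤ k a<b)))

  agree : ∀ m → coeff f m ≡ coeff (const (coeff f 𝟎)) m
  agree m with zero-or-positive m
  ... | inj₁ refl = sym (trans (coeff≡⟪,δ⟫ (const (coeff f 𝟎)) m) (trans (⟪⟫-const {n} (coeff f 𝟎) (δ m))
        (trans (cong (coeff f 𝟎 ℚ.*_) (δ-refl m)) (ℚ.*-identityʳ _))))
  ... | inj₂ (i , 0<mᵢ) = trans (descend i (suc (degree-bound i f)) m 0<mᵢ (ℕ.m≤n+m _ (lookup m i)))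
        (sym (trans (coeff≡⟪,δ⟫ (const (coeff f 𝟎)) m) (trans (⟪⟫-const {n} (coeff f 𝟎) (δ m))
          (trans (cong (coeff f 𝟎 ℚ.*_) (δ-≢ {m = m} {a = 𝟎} λ eq →
            ℕ.<⇒≢ 0<mᵢ (trans (sym (lookup-replicate i 0)) (cong (λ a → lookup a i) eq))))
            (ℚ.*-zeroʳ (coeff f 𝟎))))))

D₊-const : (c : ℚ) → D₊ n (const c) ≈ 0#
D₊-const c = sum-0 λ i → ≈-trans (*-congˡ {x = var i ^ 2} (∂-const i c)) (zeroʳ (var i ^ 2))

D₊-cong : {f g : Poly n} → f ≈ g → D₊ n f ≈ D₊ n g
D₊-cong f≈g = sum-cong-≋ λ i → *-congˡ {x = var i ^ 2} (∂-cong i f≈g)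

-- Generated subalgebras and the three claims

generated-isSubalgebra : (as : List (Poly n)) → IsSubalgebra ℚ[ as ]
generated-isSubalgebra as = record { ι-closed = const∈ ; +-closed = +∈ ; *-closed = *∈ ; ≈-closed = ≈∈ }

generated⊆ : {as : List (Poly n)} {P : Pred (Poly n) 0ℓ} → IsSubalgebra P → (∀ {a} → a ∈ as → P a) →
             ∀ {f} → ℚ[ as ] f → P f
generated⊆ {as = as} {P} sub as∈ = go
  where
  open IsSubalgebra sub
  go : ∀ {f} → ℚ[ as ] f → P f
  go (const∈ c)  = ι-closed c
  go (gen∈ a∈)   = as∈ a∈
  go (+∈ f∈ g∈)  = +-closed (go f∈) (go g∈)
  go (*∈ f∈ g∈)  = *-closed (go f∈) (go g∈)
  go (≈∈ f≈g f∈) = ≈-closed f≈g (go f∈)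

z∈zs : ∀ m → suc (suc m) ≤ n → z n (suc (suc m)) ∈ zs n
z∈zs {suc n} m (s≤s m<n) = ∈-map⁺ (z (suc n)) (∈-applyUpTo⁺ (2 ℕ.+_) m<n)

zs⊆ : {P : Pred (Poly n) 0ℓ} → (∀ m → P (z n (suc (suc m)))) → ∀ {a} → a ∈ zs n → P a
zs⊆ {n} z∈ a∈ with _ , i∈ , refl ← ∈-map⁻ (z n) a∈ with m , _ , refl ← ∈-applyUpTo⁻ (2 ℕ.+_) i∈ = z∈ m

-- At `var` the general `zᴿ` unfolds to `z`, so results about it apply as they stand.
z∈Λ : ∀ i → Λ n (z n i)
z∈Λ = z∈ var Λ-isSubalgebra p∈Λ

theorem1 : ∀ (n : ℕ) → 1 ≤ n →
    (ker (D₋ n) ≐ ℚ[ zs n ]) ×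
    (ker (D₊ n) ≐ Constant) ×
    (Λ n ≐ ℚ[ p n 1 ∷ zs n ])
theorem1 n 1≤n = (ker⊆ , ⊆ker) , (D₊-kernel ∘ proj₂ , λ {f} → const⊆ker {f}) , (Λ⊆gen , gen⊆Λ)
  where
  D₋p₁ : D₋ n (p n 1) ≈ ιℤ (+ n ℤ.* -1ℤ)
  D₋p₁ = D-powerSum-1 D₋-isDerivation var {e = -1ℤ} D₋-var

  n*-1≢0 : + n ℤ.* -1ℤ ≢ + 0
  n*-1≢0 eq with ℤ.i*j≡0⇒i≡0∨j≡0 (+ n) eq
  ... | inj₁ n≡0 = ℕ.<⇒≢ 1≤n (sym (ℤ.+-injective n≡0))

  D₋z : ∀ m → D₋ n (z n (suc (suc m))) ≈ 0#
  D₋z m = D-z D₋-isDerivation var {e = -1ℤ} D₋-var m 1≤n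

  ⊆ker : ∀ {f} → ℚ[ zs n ] f → ker (D₋ n) f
  ⊆ker f∈ = generated⊆ {P = Λ n} Λ-isSubalgebra (zs⊆ {P = Λ n} λ m → z∈Λ (suc (suc m))) f∈
          , generated⊆ (IsDerivation.kernel D₋-isDerivation) (zs⊆ {P = λ f → D₋ n f ≈ 0#} D₋z) f∈

  ker⊆ : ∀ {f} → ker (D₋ n) f → ℚ[ zs n ] f
  -- `Adjoin` rather than the algebra of (iii) describes Λₙ here, because it supplies the list of
  -- coefficients of powers of p₁ on which D₋ can be computed.
  ker⊆ (f∈Λ , D₋f≈0) = adjoin-kernel (p n 1) Q D₋-isDerivation n*-1≢0 D₋p₁ (proj₂ ∘ ⊆ker)
    (Λ⊆ (adjoin (p n 1) Q) (powerSum∈ var (adjoin (p n 1) Q) 1≤n (indeterminate∈ (p n 1) Q)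
      λ m m≤ → coefficient∈ (p n 1) Q (gen∈ (z∈zs m m≤))) f∈Λ) D₋f≈0
    where Q = generated-isSubalgebra (zs n)

  const⊆ker : ∀ {f} → Constant f → ker (D₊ n) f
  const⊆ker (c , f≈c) = IsSubalgebra.≈-closed Λ-isSubalgebra (≈-sym f≈c) (λ σ → permute-const σ c)
                      , ≈-trans (D₊-cong f≈c) (D₊-const c)

  Λ⊆gen : ∀ {f} → Λ n f → ℚ[ p n 1 ∷ zs n ] f
  Λ⊆gen = Λ⊆ G (powerSum∈ var G 1≤n (gen∈ (here refl)) λ m m≤ → gen∈ (there (z∈zs m m≤)))
    where G = generated-isSubalgebra (p n 1 ∷ zs n)

  gen⊆Λ : ∀ {f} → ℚ[ p n 1 ∷ zs n ] f → Λ n f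
  gen⊆Λ = generated⊆ {P = Λ n} Λ-isSubalgebra λ where
    (here refl) → p∈Λ 1
    (there a∈)  → zs⊆ {P = Λ n} (λ m → z∈Λ (suc (suc m))) a∈
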